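{- For each integer $i\ge 1$, let $b_i$ be the number of rooted trees $T$ (up to isomorphism of rooted trees) with exactly $i$ vertices such that $T=B_{m,p}\cdot B_{n,q}$ for some integers $m,n>0$ and $p,q\geq 0$ and such that the poset $C(T,r)$ is not rank unimodal, where $r$ is the root of $T$. Then $b_1=b_2=\cdots=b_9=0$, and for every integer $k\geq 0$ $$b_{2k+10}=2\left(\sum_{i=0}^{k}\left\lfloor\frac{i(i+4)}{4}\right\rfloor\right)-\left\lfloor\frac{k^2}{4}\right\rfloor,$$ $$b_{2k+11}=2\left(\sum_{i=0}^{k}\left\lfloor\frac{i(i+4)}{4}\right\rfloor\right)+\left\lfloor\frac{(k+1)(k+5)}{4}\right\rfloor-\left\lfloor\frac{k^2}{4}\right\rfloor.$$
   Context: For integers $m>0$ and $k\ge 0$, the broom graph $B_{m,k}$ is the rooted tree consisting of a path $x_0,x_1,\ldots,x_k$ with $k$ edges, rooted at $x_0$, together with $m$ additional pendant vertices each adjacent to $x_k$ (all edges directed away from the root). The merge $T_1\cdot T_2$ of two rooted trees is the rooted tree obtained from their disjoint union by identifying the two roots; the identified vertex is the root. For a rooted tree $T$ with root $r$, $C(T,r)$ is the poset of connected vertex-induced subtrees of $T$ containing $r$, ordered by inclusion. Its rank sequence is $(r_i)_{i\ge 1}$, where $r_i$ is the number of connected vertex-induced subtrees of $T$ containing the root with exactly $i$ vertices. The poset is rank unimodal if $(r_i)$ is unimodal, i.e. if for some $k$ we have $r_1\le\cdots\le r_k\ge r_{k+1}\ge\cdots$. -}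

module Defs where

open import Data.Fin using (Fin; zero; suc; inject₁; fromℕ; splitAt; _↑ˡ_; _↑ʳ_)
open import Data.Fin.Properties using (splitAt-↑ˡ; splitAt-↑ʳ; splitAt⁻¹-↑ˡ; splitAt⁻¹-↑ʳ)
open import Data.Fin.Subset using (Subset; _∈_; ∣_∣)
open import Data.Fin.Subset.Properties using (⊆-poset)
open import Data.List using (length; map; upTo)
open import Data.List.Relation.Unary.Enumerates.Setoid using (IsEnumeration)
open import Data.List.Relation.Unary.Unique.Setoid using (Unique)
open import Data.Nat using (ℕ; suc; _+_; _≤_; _<_; _>_)
open import Data.Nat.ListAction using (sum)
open import Data.Product using (Σ; ∃-syntax; _×_; _,_; proj₁)
open import Data.Sum using (inj₁; inj₂; [_,_]′)
open import Function using (_∘_; _↔_; _⇔_; Inverse)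
open import Function.Construct.Composition using (_↔-∘_; _⇔-∘_)
open import Function.Construct.Identity using (↔-id; ⇔-id)
open import Function.Construct.Symmetry using (↔-sym; ⇔-sym)
open import Level using (Level; 0ℓ; _⊔_)
open import Relation.Binary using (Rel; Setoid; Poset)
import Relation.Binary.Construct.On as On
open import Relation.Binary.Construct.Closure.Equivalence using (EqClosure)
open import Relation.Binary.Construct.Closure.ReflexiveTransitive using (Star; ε; _◅_; _◅◅_; gmap)
open import Relation.Binary.PropositionalEquality using (_≡_; refl; sym; trans; cong; subst; subst₂)
open import Relation.Nullary using (¬_)

private
  variable
    a ℓ : Level

-- The number of ≈-classes is n: a list of n representatives, pairwise
-- inequivalent and meeting every class.
HasCardinality : Setoid a ℓ → ℕ → Set (a ⊔ ℓ)
HasCardinality S n =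
  ∃[ xs ] Unique S xs × IsEnumeration S xs × length xs ≡ n

-- A finite rooted tree with its edges directed away from the root: every vertex
-- but the root has exactly one incoming edge, the root has none, and every vertex
-- is reachable from the root.  The vertices are Fin (suc edges) and the root is
-- zero; parent j is the parent of the vertex suc j.
record RootedTree : Set where
  field
    edges  : ℕ
    parent : Fin edges → Fin (suc edges)

  order : ℕ
  order = suc edges

  Vertex : Set
  Vertex = Fin order

  root : Vertex
  root = zero

  infix 4 _⟶_

  _⟶_ : Rel Vertex 0ℓ
  u ⟶ v = ∃[ j ] parent j ≡ u × suc j ≡ v

  field
    reachable : ∀ v → Star _⟶_ root v

open RootedTree

infix 4 _≅_

record _≅_ (T U : RootedTree) : Set where
  field
    bijection : Vertex T ↔ Vertex U

  open Inverse bijection public using (to; from; strictlyInverseˡ; strictlyInverseʳ)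

  field
    root-preserving : to (root T) ≡ root U
    edge-preserving : ∀ u v → _⟶_ T u v ⇔ _⟶_ U (to u) (to v)

≅-refl : ∀ {T} → T ≅ T
≅-refl = record
  { bijection       = ↔-id _
  ; root-preserving = refl
  ; edge-preserving = λ _ _ → ⇔-id _
  }

≅-sym : ∀ {T U} → T ≅ U → U ≅ T
≅-sym {T} {U} f = record
  { bijection       = ↔-sym bijection
  ; root-preserving = trans (cong from (sym root-preserving)) (strictlyInverseʳ (root T))
  ; edge-preserving = λ u v → ⇔-sym
      (subst₂ (λ x y → _⟶_ T (from u) (from v) ⇔ _⟶_ U x y)
        (strictlyInverseˡ u) (strictlyInverseˡ v) (edge-preserving (from u) (from v)))
  }
  where open _≅_ f

≅-trans : ∀ {T U V} → T ≅ U → U ≅ V → T ≅ V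
≅-trans f g = record
  { bijection       = G.bijection ↔-∘ F.bijection
  ; root-preserving = trans (cong G.to F.root-preserving) G.root-preserving
  ; edge-preserving = λ u v → G.edge-preserving _ _ ⇔-∘ F.edge-preserving u v
  }
  where
  module F = _≅_ f
  module G = _≅_ g

rootedTreeSetoid : Setoid 0ℓ 0ℓ
rootedTreeSetoid = record
  { Carrier       = RootedTree
  ; _≈_           = _≅_
  ; isEquivalence = record { refl = ≅-refl ; sym = ≅-sym ; trans = ≅-trans }
  }

-- Vertex numbering of broom m k: the path x₀, …, x_k is 0, …, k, followed by the
-- m pendant vertices.
module _ (m k : ℕ) where

  broomPath : Fin (suc k) → Fin (suc k + m)
  broomPath i = i ↑ˡ m

  broomParent : Fin (k + m) → Fin (suc k + m)
  broomParent =
    [ (λ i → broomPath (inject₁ i)) , (λ _ → broomPath (fromℕ k)) ]′ ∘ splitAt k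

broom : (m k : ℕ) → RootedTree
broom m k = record
  { edges     = k + m
  ; parent    = broomParent m k
  ; reachable = reach
  }
  where
  _⇝_ : Rel (Fin (suc k + m)) 0ℓ
  u ⇝ v = ∃[ j ] broomParent m k j ≡ u × suc j ≡ v

  reachPath : ∀ {l} (x : Fin (suc l) → Fin (suc k + m)) →
              (∀ i → x (inject₁ i) ⇝ x (suc i)) → ∀ i → Star _⇝_ (x zero) (x i)
  reachPath             x e zero    = ε
  reachPath {l = suc _} x e (suc i) =
    e zero ◅ reachPath (x ∘ suc) (e ∘ suc) i

  pathEdge : ∀ i → broomPath m k (inject₁ i) ⇝ broomPath m k (suc i)
  pathEdge i = i ↑ˡ m , cong [ _ , _ ]′ (splitAt-↑ˡ k i m) , refl

  onPath : ∀ i → Star _⇝_ zero (broomPath m k i)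
  onPath = reachPath (broomPath m k) pathEdge

  reach : ∀ v → Star _⇝_ zero v
  reach zero    = ε
  reach (suc j) with splitAt k j in eq
  ... | inj₁ i = subst (Star _⇝_ zero) (cong suc (splitAt⁻¹-↑ˡ eq)) (onPath (suc i))
  ... | inj₂ _ = onPath (fromℕ k) ◅◅ (j , cong [ _ , _ ]′ eq , refl) ◅ ε

-- The inclusions of the two vertex sets into that of the merge; both send root to
-- root.
module _ (T U : RootedTree) where

  mergeˡ : Vertex T → Fin (suc (edges T + edges U))
  mergeˡ v = v ↑ˡ edges U

  mergeʳ : Vertex U → Fin (suc (edges T + edges U))
  mergeʳ zero    = zero
  mergeʳ (suc j) = suc (edges T ↑ʳ j)

  mergeParent : Fin (edges T + edges U) → Fin (suc (edges T + edges U))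
  mergeParent = [ mergeˡ ∘ parent T , mergeʳ ∘ parent U ]′ ∘ splitAt (edges T)

infixl 7 _·_

_·_ : RootedTree → RootedTree → RootedTree
T · U = record
  { edges     = edges T + edges U
  ; parent    = mergeParent T U
  ; reachable = reach
  }
  where
  _⇝_ : Rel (Fin (suc (edges T + edges U))) 0ℓ
  u ⇝ v = ∃[ j ] mergeParent T U j ≡ u × suc j ≡ v

  edgeˡ : ∀ {u v} → _⟶_ T u v → mergeˡ T U u ⇝ mergeˡ T U v
  edgeˡ (j , refl , refl) =
    j ↑ˡ edges U , cong [ _ , _ ]′ (splitAt-↑ˡ (edges T) j (edges U)) , refl

  edgeʳ : ∀ {u v} → _⟶_ U u v → mergeʳ T U u ⇝ mergeʳ T U v
  edgeʳ (j , refl , refl) =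
    edges T ↑ʳ j , cong [ _ , _ ]′ (splitAt-↑ʳ (edges T) (edges U) j) , refl

  reach : ∀ v → Star _⇝_ zero v
  reach zero    = ε
  reach (suc j) with splitAt (edges T) j in eq
  ... | inj₁ i = subst (Star _⇝_ zero) (cong suc (splitAt⁻¹-↑ˡ eq))
                   (gmap (mergeˡ T U) edgeˡ (reachable T (suc i)))
  ... | inj₂ i = subst (Star _⇝_ zero) (cong suc (splitAt⁻¹-↑ʳ eq))
                   (gmap (mergeʳ T U) edgeʳ (reachable U (suc i)))

module _ (T : RootedTree) where

  InducedEdge : Subset (order T) → Rel (Vertex T) 0ℓ
  InducedEdge S u v = u ∈ S × v ∈ S × _⟶_ T u v

  -- The subgraph induced on S is connected, edge directions being ignored.
  Connected : Subset (order T) → Set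
  Connected S = ∀ {u v} → u ∈ S → v ∈ S → EqClosure (InducedEdge S) u v

  RootedSubtree : Set
  RootedSubtree = ∃[ S ] root T ∈ S × Connected S

  C : Poset 0ℓ 0ℓ 0ℓ
  C = On.poset {B = RootedSubtree} (⊆-poset (order T)) proj₁

  rankSetoid : ℕ → Setoid 0ℓ 0ℓ
  rankSetoid i =
    On.setoid {B = Σ RootedSubtree λ (S , _) → ∣ S ∣ ≡ i} (Poset.Eq.setoid C) proj₁

  IsRankSequence : (ℕ → ℕ) → Set
  IsRankSequence r = ∀ i → 1 ≤ i → HasCardinality (rankSetoid i) (r i)

-- Sequences are indexed from 1; the value at 0 is never used.
Unimodal : (ℕ → ℕ) → Set
Unimodal r = ∃[ k ] 1 ≤ k
  × (∀ i → 1 ≤ i → i < k → r i ≤ r (suc i))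
  × (∀ i → k ≤ i → r (suc i) ≤ r i)

RankUnimodal : RootedTree → Set
RankUnimodal T = ∃[ r ] IsRankSequence T r × Unimodal r

IsBroomMerge : RootedTree → Set
IsBroomMerge T =
  ∃[ m ] ∃[ p ] ∃[ n ] ∃[ q ] m > 0 × n > 0 × T ≅ broom m p · broom n q

nonUnimodalBroomMerges : ℕ → Setoid 0ℓ 0ℓ
nonUnimodalBroomMerges i =
  On.setoid
    {B = ∃[ T ] order T ≡ i × IsBroomMerge T × ¬ RankUnimodal T}
    rootedTreeSetoid proj₁

-- The sum of f i over 0 ≤ i ≤ k.
sumTo : ℕ → (ℕ → ℕ) → ℕ
sumTo k f = sum (map f (upTo (suc k)))

{-# OPTIONS --safe #-}
-- A rooted subtree is a set of vertices containing the root and closed under taking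
-- parents.  Hence the rank polynomial of broom m p divided by x is
--   A = 1 + x + … + x^(p-1) + x^p (1 + x)^m,
-- and that of a merge is x times the product of two such factors.  Multiplying the
-- product by 1 - x shows that the rank sequence of broom m p · broom n q changes by
--   C(n,p+j) - C(n,j) + C(m,q+j) - C(m,j) + C(m+n,j) - C(m+n,j-1)
-- in passing to rank p + q + j + 1.  If p ≥ n and q ≥ m, this is -1 for j = 1 and
-- mn - m - n for j = 2, so unimodality fails when the latter is positive.  In all
-- other cases the changes go from nonnegative to nonpositive only once; the reason is
-- that multiplication by 1 + x preserves this property.
--
-- So the nonunimodal merges are those with m, n ≥ 2, m + n ≥ 5, p ≥ n, q ≥ m.  The
-- vertices at positive depth with at least two children recover the unordered pair
-- {(m,p), (n,q)} from the tree.  Subtracting the lower bounds from the parameters, the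
-- merges with m < n and with m = n are counted by the coefficients of
--   x^11 / (1-x)^2 (1-x^2) (1-x^4)  and  x^13 / (1-x) (1-x^2) (1-x^4).
module Submission where

open import Defs
open import Data.Nat using (ℕ; _≤_; _+_; _*_; _^_; _/_)
open import Data.Integer as ℤ using (+_)
open import Data.Product using (∃; _×_)
open import Relation.Binary.PropositionalEquality using (_≡_)

import Algebra.Properties.CommutativeMonoid.Sum as Sum
open import Data.Bool using (Bool; if_then_else_)
open import Data.Fin using (Fin; zero; suc; splitAt; join; _↑ˡ_; _↑ʳ_)
open import Data.Fin.Permutation using (↔⇒≡)
open import Data.Fin.Properties using (splitAt-↑ˡ; splitAt-↑ʳ; suc-injective; ↑ˡ-injective; injective⇒≤)
open import Data.Fin.Subset using (Subset; inside; outside; ∣_∣; _∈_; ⊥)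
open import Data.Fin.Subset.Properties using (∉⊥; ∣⊥∣≡0; Empty-unique; drop-there)
open import Data.Integer using (ℤ; 0ℤ; 1ℤ; -1ℤ)
import Data.Integer.Properties as ℤ
open import Data.Integer.Tactic.RingSolver using (solve-∀)
import Data.List as List
open import Data.List using ([]; _∷_)
open import Data.List.Membership.Propositional.Properties using (∈-lookup)
import Data.List.Membership.Setoid as Membership
import Data.List.Membership.Setoid.Properties as Membershipₚ
open import Data.List.Properties using (length-map; length-++; upTo-∷ʳ; map-++)
open import Data.List.Relation.Unary.All as All using (All)
open import Data.List.Relation.Unary.AllPairs using ([]; _∷_)
open import Data.List.Relation.Unary.Any using (here; index)
open import Data.List.Relation.Unary.Unique.Setoid using (Unique)
import Data.List.Relation.Unary.Unique.Setoid.Properties as Unique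
open import Data.Maybe using (Maybe; just; nothing)
open import Data.Nat using (zero; suc; _<_; z≤n; s≤s; z<s; _≤?_; _<?_)
open import Data.Nat.Combinatorics using (nCn≡1; nC1≡n; nCk≡nC[n∸k]; nCk+nC[k+1]≡[n+1]C[k+1]; k>n⇒nCk≡0) renaming (_C_ to _choose_)
open import Data.Nat.DivMod using (+-distrib-/-∣ʳ; m*n/n≡m)
open import Data.Nat.Divisibility using (n∣m*n)
open import Data.Nat.Induction using (<-rec)
open import Data.Nat.ListAction using (sum)
open import Data.Nat.ListAction.Properties using (sum-++)
import Data.Nat.Properties as ℕ
import Data.Nat.Tactic.RingSolver as ℕ
open import Data.Product using (_,_; proj₁; proj₂)
open import Data.Sum using (_⊎_; inj₁; inj₂; swap)
open import Data.Unit using (⊤; tt)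
open import Data.Vec using ([]; _∷_; _++_; here; there; lookup; tabulate)
import Data.Vec as Vec
open import Data.Vec.Properties using (++-injective; []=⇒lookup; lookup⇒[]=; lookup∘tabulate; tabulate∘lookup; tabulate-cong; ∷-injectiveʳ)
open import Function using (_∘_; flip; Equivalence; mk⇔; mk↔ₛ′)
open import Level using (Level; 0ℓ)
open import Relation.Binary using (Setoid)
open import Relation.Binary.Construct.Closure.Equivalence using (EqClosure)
import Relation.Binary.Construct.Closure.Equivalence as EqClosure
open import Relation.Binary.Construct.Closure.ReflexiveTransitive using (Star; ε; _◅_)
open import Relation.Binary.Construct.Closure.Symmetric using (fwd; bwd)
import Relation.Binary.Construct.On as On
open import Relation.Binary.Definitions using (tri<; tri≈; tri>)
open import Relation.Binary.PropositionalEquality using (refl; sym; trans; cong; cong₂; subst; subst₂; _≗_; setoid; module ≡-Reasoning)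
open import Relation.Nullary using (¬_; Dec; yes; no)
open import Relation.Nullary.Decidable using (_×-dec_)
open import Relation.Nullary.Negation using (contradiction)

-- Signed binomial and ballot numbers

opaque

  -- Integer values allow differences without truncation. Opacity keeps closed values such as
  -- `binom 0 2` from computing, so that rewriting can find them.
  binom : ℕ → ℕ → ℤ
  binom n k = + (n choose k)

  pascal : ∀ n k → binom (suc n) (suc k) ≡ binom n k ℤ.+ binom n (suc k)
  pascal n k = cong +_ (sym (nCk+nC[k+1]≡[n+1]C[k+1] n k))

  binom-0 : ∀ n → binom n 0 ≡ 1ℤ
  binom-0 n = cong +_ (trans (nCk≡nC[n∸k] {0} {n} z≤n) (nCn≡1 n))

  binom-1 : ∀ n → binom n 1 ≡ + n
  binom-1 n = cong +_ (nC1≡n n)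

  binom-vanishes : ∀ {n k} → n < k → binom n k ≡ 0ℤ
  binom-vanishes n<k = cong +_ (k>n⇒nCk≡0 n<k)

  binom-nonneg : ∀ n k → 0ℤ ℤ.≤ binom n k
  binom-nonneg n k = ℤ.+≤+ z≤n

binom-mono : ∀ n k → binom n k ℤ.≤ binom (suc n) k
binom-mono n zero    = ℤ.≤-reflexive (trans (binom-0 n) (sym (binom-0 (suc n))))
binom-mono n (suc k) = begin
  binom n (suc k)                ≡⟨ ℤ.+-identityˡ _ ⟨
  0ℤ ℤ.+ binom n (suc k)         ≤⟨ ℤ.+-monoˡ-≤ (binom n (suc k)) (binom-nonneg n k) ⟩
  binom n k ℤ.+ binom n (suc k)  ≡⟨ pascal n k ⟨
  binom (suc n) (suc k)          ∎
  where open ℤ.≤-Reasoning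

binom-positive : ∀ {n k} → k ≤ n → 1ℤ ℤ.≤ binom n k
binom-positive {n} {zero} _ = ℤ.≤-reflexive (sym (binom-0 n))
binom-positive {suc n} {suc k} (s≤s k≤n) = begin
  1ℤ                             ≤⟨ ℤ.+-mono-≤ (binom-positive k≤n) (binom-nonneg n (suc k)) ⟩
  binom n k ℤ.+ binom n (suc k)  ≡⟨ pascal n k ⟨
  binom (suc n) (suc k)          ∎
  where open ℤ.≤-Reasoning

-- Vandermonde's identity for pairs: a pair from a disjoint union lies within one part or has one
-- element in each. The cross term is the source of `mn` in `increment-2`.
binom-2-+ : ∀ m n → binom (m + n) 2 ≡ binom m 2 ℤ.+ binom n 2 ℤ.+ + m ℤ.* + n
binom-2-+ zero    n rewrite binom-vanishes {0} {2} z<s = lemma (binom n 2) (+ n)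
  where
  lemma : ∀ a b → a ≡ 0ℤ ℤ.+ a ℤ.+ 0ℤ ℤ.* b
  lemma = solve-∀
binom-2-+ (suc m) n
  rewrite pascal (m + n) 1 | pascal m 1 | binom-1 (m + n) | binom-1 m | binom-2-+ m n
  = lemma (+ m) (+ n) (binom m 2) (binom n 2)
  where
  lemma : ∀ x y a b → x ℤ.+ y ℤ.+ (a ℤ.+ b ℤ.+ x ℤ.* y) ≡ x ℤ.+ a ℤ.+ b ℤ.+ (1ℤ ℤ.+ x) ℤ.* y
  lemma = solve-∀

-- The coefficients of `(1 - x) (1 + x)^n`; at index 0 nothing is subtracted.
ballot : ℕ → ℕ → ℤ
ballot n zero    = 1ℤ
ballot n (suc k) = binom n (suc k) ℤ.- binom n k

opaque

  unfolding binom

  ballot-4-3 : ballot 4 3 ≡ ℤ.- + 2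
  ballot-4-3 = refl

-- Raising `n` multiplies `(1 - x) (1 + x)^n` by `1 + x`.
ballot-pascal : ∀ n k → ballot (suc n) (suc k) ≡ ballot n (suc k) ℤ.+ ballot n k
ballot-pascal n zero
  rewrite pascal n 0 | binom-0 (suc n) | binom-0 n = lemma (binom n 1)
  where
  lemma : ∀ a → 1ℤ ℤ.+ a ℤ.- 1ℤ ≡ a ℤ.- 1ℤ ℤ.+ 1ℤ
  lemma = solve-∀
ballot-pascal n (suc k)
  rewrite pascal n (suc k) | pascal n k = lemma (binom n k) (binom n (suc k)) (binom n (suc (suc k)))
  where
  lemma : ∀ a b c → b ℤ.+ c ℤ.- (a ℤ.+ b) ≡ c ℤ.- b ℤ.+ (b ℤ.- a)
  lemma = solve-∀

-- Sequences that change sign at most once, from nonnegative to nonpositive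

SignChange : (ℕ → ℤ) → Set
SignChange f = ∀ {i j} → i ≤ j → f i ℤ.< 0ℤ → f j ℤ.≤ 0ℤ

signChange-cong : ∀ {f g} → f ≗ g → SignChange f → SignChange g
signChange-cong f≗g sf {i} {j} i≤j gi<0 =
  subst (ℤ._≤ 0ℤ) (f≗g j) (sf i≤j (subst (ℤ._< 0ℤ) (sym (f≗g i)) gi<0))

signChange-tail : ∀ {f} → 0ℤ ℤ.≤ f 0 → SignChange (f ∘ suc) → SignChange f
signChange-tail f₀≥0 sf {zero}          _         f₀<0 = contradiction f₀≥0 (ℤ.<⇒≱ f₀<0)
signChange-tail f₀≥0 sf {suc _} {suc _} (s≤s i≤j) fi<0 = sf i≤j fi<0

-- Multiplication by 1 + x, up to a nonnegative correction of the constant term,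
-- preserves the sign pattern.
signChange-pascal : ∀ {f g} →
  f 0 ℤ.≤ g 0 → (∀ k → g (suc k) ≡ f (suc k) ℤ.+ f k) →
  SignChange f → SignChange g
signChange-pascal {f} {g} f₀≤g₀ step sf {i} {j} i≤j gi<0 with ℕ.m≤n⇒m<n∨m≡n i≤j
... | inj₂ refl = ℤ.<⇒≤ gi<0
signChange-pascal {f} {g} f₀≤g₀ step sf {i} {suc j} i≤j gi<0 | inj₁ (s≤s i≤j′) =
  let k , k≤i , fk<0 = negative i gi<0 in begin
    g (suc j)          ≡⟨ step j ⟩
    f (suc j) ℤ.+ f j  ≤⟨ ℤ.+-mono-≤ (sf (ℕ.≤-trans k≤i i≤j) fk<0) (sf (ℕ.≤-trans k≤i i≤j′) fk<0) ⟩
    0ℤ                 ∎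
  where
  open ℤ.≤-Reasoning
  -- A negative `g i` forces a negative value of `f` at `i` or just before it, after which `f` stays
  -- nonpositive.
  negative : ∀ i → g i ℤ.< 0ℤ → ∃ λ k → k ≤ i × f k ℤ.< 0ℤ
  negative zero    g₀<0 = 0 , z≤n , ℤ.≤-<-trans f₀≤g₀ g₀<0
  negative (suc i) g<0 with 0ℤ ℤ.≤? f i
  ... | no  fi≱0 = i , ℕ.n≤1+n i , ℤ.≰⇒> fi≱0
  ... | yes fi≥0 = suc i , ℕ.≤-refl , (begin-strict
    f (suc i)          ≡⟨ ℤ.+-identityʳ _ ⟨
    f (suc i) ℤ.+ 0ℤ   ≤⟨ ℤ.+-monoʳ-≤ (f (suc i)) fi≥0 ⟩
    f (suc i) ℤ.+ f i  ≡⟨ step i ⟨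
    g (suc i)          <⟨ g<0 ⟩
    0ℤ                 ∎)

-- The base case is `1 - x`; each factor `1 + x` is an instance of `signChange-pascal`.
ballot-signChange : ∀ n → SignChange (ballot n)
ballot-signChange zero {zero}  {zero}        _ (ℤ.+<+ ())
ballot-signChange zero {_}     {suc j}       _ _ rewrite binom-vanishes {0} {suc j} z<s =
  ℤ.i≤j⇒i-j≤0 (binom-nonneg 0 j)
ballot-signChange (suc n) =
  signChange-pascal ℤ.≤-refl (ballot-pascal n) (ballot-signChange n)

-- The coefficient of x^(p+q+j) in (1 - x) A_{m,p} A_{n,q}.
increment : (m p n q j : ℕ) → ℤ
increment m p n q j =
  (binom n (p + j) ℤ.- binom n j) ℤ.+ (binom m (q + j) ℤ.- binom m j) ℤ.+ ballot (n + m) j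

increment-comm : ∀ m p n q j → increment m p n q j ≡ increment n q m p j
increment-comm m p n q j =
  cong₂ ℤ._+_ (ℤ.+-comm (binom n (p + j) ℤ.- binom n j) _) (cong (λ s → ballot s j) (ℕ.+-comm n m))

module _ (s m p q : ℕ) where

  private
    G : ℕ → ℕ → ℤ
    G s j = binom s (p + j) ℤ.- binom s j ℤ.+ ballot (s + m) j

    -- U 0 agrees with G s from index 2 on, U m is the increment, and the step from
    -- U t to U (suc t) preserves the sign pattern from index 2 on as U t 1 ≥ 0.
    U : ℕ → ℕ → ℤ
    U t j = (binom (t + s) (p + j) ℤ.- binom (t + s) j) ℤ.+ (binom t (q + j) ℤ.- binom t j)
            ℤ.+ ballot (t + s + m) j

    binom-diff-pascal : ∀ s p j →
      binom (suc s) (p + suc j) ℤ.- binom (suc s) (suc j) ≡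
      (binom s (p + suc j) ℤ.- binom s (suc j)) ℤ.+ (binom s (p + j) ℤ.- binom s j)
    binom-diff-pascal s p j rewrite ℕ.+-suc p j | pascal s (p + j) | pascal s j =
      lemma (binom s (p + j)) (binom s (suc (p + j))) (binom s j) (binom s (suc j))
      where
      lemma : ∀ a b c d → a ℤ.+ b ℤ.- (c ℤ.+ d) ≡ b ℤ.- d ℤ.+ (a ℤ.- c)
      lemma = solve-∀

    -- Raising `s` multiplies by `1 + x`, except that `(1 + x)^s` is cut off below degree `p`, which
    -- can only increase the constant term; `signChange-pascal` allows this. For `s = 0`, only the
    -- ballot numbers of `m` remain after the constant term.
    G-signChange : ∀ s → SignChange (G s)
    G-signChange zero = signChange-tail
      (subst (0ℤ ℤ.≤_) (sym G₀) (binom-nonneg 0 (p + 0)))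
      (signChange-cong (sym ∘ G₊) λ i≤j → ballot-signChange m (s≤s i≤j))
      where
      lemma : ∀ a → a ℤ.- 1ℤ ℤ.+ 1ℤ ≡ a
      lemma = solve-∀
      G₀ : G 0 0 ≡ binom 0 (p + 0)
      G₀ rewrite binom-0 0 = lemma (binom 0 (p + 0))
      G₊ : ∀ j → G 0 (suc j) ≡ ballot m (suc j)
      G₊ j rewrite binom-vanishes {0} {p + suc j} (ℕ.m≤n⇒m≤o+n p z<s) | binom-vanishes {0} {suc j} z<s =
        ℤ.+-identityˡ _
    G-signChange (suc s) = signChange-pascal
      (ℤ.+-monoˡ-≤ 1ℤ (ℤ.+-mono-≤ (binom-mono s (p + 0)) (ℤ.≤-reflexive (cong ℤ.-_ (trans (binom-0 s) (sym (binom-0 (suc s))))))))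
      (λ j → trans (cong₂ ℤ._+_ (binom-diff-pascal s p j) (ballot-pascal (s + m) j))
                   (lemma (binom s (p + suc j) ℤ.- binom s (suc j)) (binom s (p + j) ℤ.- binom s j) _ _))
      (G-signChange s)
      where
      lemma : ∀ a b c d → a ℤ.+ b ℤ.+ (c ℤ.+ d) ≡ a ℤ.+ c ℤ.+ (b ℤ.+ d)
      lemma = solve-∀

    U-pascal : ∀ t j → U (suc t) (suc j) ≡ U t (suc j) ℤ.+ U t j
    U-pascal t j = trans
      (cong₂ ℤ._+_ (cong₂ ℤ._+_ (binom-diff-pascal (t + s) p j) (binom-diff-pascal t q j)) (ballot-pascal (t + s + m) j))
      (lemma (binom (t + s) (p + suc j) ℤ.- binom (t + s) (suc j)) (binom (t + s) (p + j) ℤ.- binom (t + s) j)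
             (binom t (q + suc j) ℤ.- binom t (suc j)) (binom t (q + j) ℤ.- binom t j) _ _)
      where
      lemma : ∀ a a′ b b′ c c′ → a ℤ.+ a′ ℤ.+ (b ℤ.+ b′) ℤ.+ (c ℤ.+ c′) ≡ a ℤ.+ b ℤ.+ c ℤ.+ (a′ ℤ.+ b′ ℤ.+ c′)
      lemma = solve-∀

    -- The linear terms `- (t + s) - t` and `t + s + m - 1` add up to `m - 1 - t`, which is
    -- nonnegative as long as `t < m`.
    U-1-nonneg : ∀ {t} → t < m → 0ℤ ℤ.≤ U t 1
    U-1-nonneg {t} t<m
      rewrite binom-1 (t + s) | binom-1 t | binom-1 (t + s + m) | binom-0 (t + s + m) = begin
      0ℤ
        ≤⟨ ℤ.+-mono-≤ (ℤ.+-mono-≤ (binom-nonneg (t + s) (p + 1)) (binom-nonneg t (q + 1))) (ℤ.i≤j⇒0≤j-i (ℤ.+≤+ t<m)) ⟩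
      binom (t + s) (p + 1) ℤ.+ binom t (q + 1) ℤ.+ (+ m ℤ.- (1ℤ ℤ.+ + t))
        ≡⟨ lemma (binom (t + s) (p + 1)) (binom t (q + 1)) (+ t) (+ s) (+ m) ⟩
      (binom (t + s) (p + 1) ℤ.- + (t + s)) ℤ.+ (binom t (q + 1) ℤ.- + t) ℤ.+ (+ (t + s + m) ℤ.- 1ℤ) ∎
      where
      open ℤ.≤-Reasoning
      lemma : ∀ a b t s m → a ℤ.+ b ℤ.+ (m ℤ.- (1ℤ ℤ.+ t)) ≡ a ℤ.- (t ℤ.+ s) ℤ.+ (b ℤ.- t) ℤ.+ (t ℤ.+ s ℤ.+ m ℤ.- 1ℤ)
      lemma = solve-∀

    U₀-tail : ∀ j → U 0 (2 + j) ≡ G s (2 + j)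
    U₀-tail j rewrite binom-vanishes {0} {q + (2 + j)} (ℕ.m≤n⇒m≤o+n q z<s) | binom-vanishes {0} {2 + j} z<s =
      cong (ℤ._+ ballot (s + m) (2 + j)) (ℤ.+-identityʳ (binom s (p + (2 + j)) ℤ.- binom s (2 + j)))

    U-signChange : ∀ t → t ≤ m → SignChange (λ j → U t (2 + j))
    U-signChange zero _ = signChange-cong (sym ∘ U₀-tail) λ i≤j → G-signChange s (s≤s (s≤s i≤j))
    U-signChange (suc t) t<m = signChange-pascal
      (begin
        U t 2              ≡⟨ ℤ.+-identityʳ _ ⟨
        U t 2 ℤ.+ 0ℤ       ≤⟨ ℤ.+-monoʳ-≤ (U t 2) (U-1-nonneg t<m) ⟩
        U t 2 ℤ.+ U t 1    ≡⟨ U-pascal t 1 ⟨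
        U (suc t) 2        ∎)
      (λ j → U-pascal t (2 + j))
      (U-signChange t (ℕ.<⇒≤ t<m))
      where open ℤ.≤-Reasoning

  increment-signChange-≤ : SignChange (λ j → increment m p (m + s) q (2 + j))
  increment-signChange-≤ = U-signChange m ℕ.≤-refl

-- By symmetry the larger star has size `m + s`, and the increments arise from those of star sizes
-- `s` and 0 by `m` steps of multiplication by `1 + x`. The index cannot start at 1: for nonunimodal
-- parameters the value there is -1 and the next one is positive.
increment-signChange : ∀ m p n q → SignChange (λ j → increment m p n q (2 + j))
increment-signChange m p n q with ℕ.≤-total m n
... | inj₁ m≤n with s , refl ← ℕ.m≤n⇒∃[o]m+o≡n m≤n = increment-signChange-≤ s m p q
... | inj₂ n≤m with s , refl ← ℕ.m≤n⇒∃[o]m+o≡n n≤m =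
  signChange-cong (λ j → increment-comm n q (n + s) p (2 + j)) (increment-signChange-≤ s n q p)

-- The rank polynomial of a merge of brooms

-- Polynomials are given by coefficient sequences, and multiplication by a fixed factor is an
-- operator on sequences, so no convolution occurs. This is the polynomial 1, to which the operators
-- are applied.
δ : ℕ → ℕ
δ zero    = 1
δ (suc _) = 0

times1+x : (ℕ → ℕ) → ℕ → ℕ
times1+x f zero    = f zero
times1+x f (suc i) = f (suc i) + f i

timesStar : ℕ → (ℕ → ℕ) → ℕ → ℕ
timesStar zero    f = f
timesStar (suc m) f = times1+x (timesStar m f)

-- Multiplication by 1 + x + … + x^(p-1) + x^p (1 + x)^m, which is the rank
-- polynomial of broom m p divided by x.
timesBroom : (m p : ℕ) → (ℕ → ℕ) → ℕ → ℕ
timesBroom m       zero    f i       = timesStar m f i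
timesBroom m       (suc p) f zero    = f zero
timesBroom m       (suc p) f (suc i) = f (suc i) + timesBroom m p f i

mergeRank : (m p n q : ℕ) → ℕ → ℕ
mergeRank m p n q = timesBroom m p (timesBroom n q δ)

-- The coefficients of `(1 - x) f`.
diff : (ℕ → ℕ) → ℕ → ℤ
diff f zero    = + f zero
diff f (suc i) = + f (suc i) ℤ.- + f i

diff-times1+x : ∀ f i → diff (times1+x f) (suc i) ≡ diff f (suc i) ℤ.+ diff f i
diff-times1+x f zero    = lemma (+ f 1) (+ f 0)
  where
  lemma : ∀ a b → a ℤ.+ b ℤ.- b ≡ a ℤ.- b ℤ.+ b
  lemma = solve-∀
diff-times1+x f (suc i) = lemma (+ f (2 + i)) (+ f (1 + i)) (+ f i)
  where
  lemma : ∀ a b c → a ℤ.+ b ℤ.- (b ℤ.+ c) ≡ a ℤ.- b ℤ.+ (b ℤ.- c)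
  lemma = solve-∀

diff-timesBroom : ∀ m p f i →
  diff (timesBroom m (suc p) f) (suc i) ≡ diff f (suc i) ℤ.+ diff (timesBroom m p f) i
diff-timesBroom m p f zero    = lemma (+ f 1) (+ timesBroom m p f 0) (+ f 0)
  where
  lemma : ∀ a b c → a ℤ.+ b ℤ.- c ≡ a ℤ.- c ℤ.+ b
  lemma = solve-∀
diff-timesBroom m p f (suc i) =
  lemma (+ f (2 + i)) (+ timesBroom m p f (1 + i)) (+ f (1 + i)) (+ timesBroom m p f i)
  where
  lemma : ∀ a b c d → a ℤ.+ b ℤ.- (c ℤ.+ d) ≡ a ℤ.- c ℤ.+ (b ℤ.- d)
  lemma = solve-∀

-- Below degree `p` the broom factor agrees with `1 / (1 - x)`, which the factor `1 - x` cancels.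
diff-timesBroom-low : ∀ m p f {i} → i < p → diff (timesBroom m p f) i ≡ + f i
diff-timesBroom-low m (suc p) f {zero}  _         = refl
diff-timesBroom-low m (suc p) f {suc i} (s≤s i<p) = trans
  (diff-timesBroom m p f i)
  (trans (cong (ℤ._+_ (diff f (suc i))) (diff-timesBroom-low m p f i<p))
         (lemma (+ f (suc i)) (+ f i)))
  where
  lemma : ∀ a b → a ℤ.- b ℤ.+ b ≡ a
  lemma = solve-∀

-- The broom factor times `1 - x` is `1 - x^p + x^p (1 - x) (1 + x)^m`; the three terms on the right
-- come from these three parts.
diff-timesBroom-high : ∀ m p f j →
  diff (timesBroom m p f) (p + j) ≡ + f (p + j) ℤ.- + f j ℤ.+ diff (timesStar m f) j
diff-timesBroom-high m zero    f j = lemma (+ f j) _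
  where
  lemma : ∀ a b → b ≡ a ℤ.- a ℤ.+ b
  lemma = solve-∀
diff-timesBroom-high m (suc p) f j = trans
  (diff-timesBroom m p f (p + j))
  (trans (cong (ℤ._+_ (diff f (suc p + j))) (diff-timesBroom-high m p f j))
         (lemma (+ f (suc p + j)) (+ f (p + j)) (+ f j) _))
  where
  lemma : ∀ a b c d → a ℤ.- b ℤ.+ (b ℤ.- c ℤ.+ d) ≡ a ℤ.- c ℤ.+ d
  lemma = solve-∀

broomRank : (n q : ℕ) → ℕ → ℕ
broomRank n q = timesBroom n q δ

broomRank-low : ∀ n q {i} → i < q → + broomRank n q i ≡ 1ℤ
broomRank-low n (suc q) {zero}  _         = refl
broomRank-low n (suc q) {suc i} (s≤s i<q) = broomRank-low n q i<q

broomRank-high : ∀ n q j → + broomRank n q (q + j) ≡ binom n j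
broomRank-high zero    zero    zero    = sym (binom-0 0)
broomRank-high zero    zero    (suc j) = sym (binom-vanishes z<s)
broomRank-high (suc n) zero    zero    =
  trans (broomRank-high n zero zero) (trans (binom-0 n) (sym (binom-0 (suc n))))
broomRank-high (suc n) zero    (suc j) = trans
  (cong₂ ℤ._+_ (broomRank-high n zero (suc j)) (broomRank-high n zero j))
  (trans (ℤ.+-comm (binom n (suc j)) (binom n j)) (sym (pascal n j)))
broomRank-high n       (suc q) j       = broomRank-high n q j

-- Below degree `q`, `A_{n,q}` agrees with `1 / (1 - x)`, so only `(1 + x)^m` is left.
diff-star-low : ∀ m n q {j} → j < q → diff (timesStar m (broomRank n q)) j ≡ binom m j
diff-star-low zero    n q {zero}  j<q = trans (broomRank-low n q j<q) (sym (binom-0 0))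
diff-star-low zero    n q {suc j} j<q
  rewrite binom-vanishes {0} {suc j} z<s | broomRank-low n q j<q | broomRank-low n q (ℕ.<⇒≤ j<q) = refl
diff-star-low (suc m) n q {zero}  j<q =
  trans (diff-star-low m n q j<q) (trans (binom-0 m) (sym (binom-0 (suc m))))
diff-star-low (suc m) n q {suc j} j<q = trans
  (diff-times1+x (timesStar m (broomRank n q)) j)
  (trans (cong₂ ℤ._+_ (diff-star-low m n q j<q) (diff-star-low m n q (ℕ.<⇒≤ j<q)))
         (trans (ℤ.+-comm (binom m (suc j)) (binom m j)) (sym (pascal m j))))

-- The polynomial in question is `(1 + x)^m (1 - x^q) + x^q (1 - x) (1 + x)^(n+m)`.
diff-star-high : ∀ m n q j → diff (timesStar m (broomRank n q)) (q + j) ≡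
  binom m (q + j) ℤ.- binom m j ℤ.+ ballot (n + m) j
diff-star-high zero n zero zero
  rewrite broomRank-high n 0 0 | binom-0 0 | binom-0 n = refl
diff-star-high zero n (suc q) zero
  rewrite broomRank-high n (suc q) 0 | broomRank-low n (suc q) {q + 0} (s≤s (ℕ.≤-reflexive (ℕ.+-identityʳ q)))
        | binom-0 0 | binom-0 n | binom-vanishes {0} {suc (q + 0)} z<s = refl
diff-star-high zero n q (suc j)
  rewrite ℕ.+-identityʳ n | ℕ.+-suc q j | binom-vanishes {0} {suc (q + j)} z<s | binom-vanishes {0} {suc j} z<s
  = trans (cong₂ ℤ._-_ (trans (cong (λ i → + broomRank n q i) (sym (ℕ.+-suc q j))) (broomRank-high n q (suc j)))
                       (broomRank-high n q j))
          (sym (ℤ.+-identityˡ _))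
diff-star-high (suc m) n zero zero
  rewrite diff-star-high m n 0 0 | binom-0 m | binom-0 (suc m) = refl
-- At `j = 0` the factor `1 + x` reaches one index below the high range, where `diff-star-low` gives
-- the value.
diff-star-high (suc m) n (suc q) zero = trans
  (diff-times1+x (timesStar m (broomRank n (suc q))) (q + 0))
  (trans (cong₂ ℤ._+_ (diff-star-high m n (suc q) 0)
                      (diff-star-low m n (suc q) (s≤s (ℕ.≤-reflexive (ℕ.+-identityʳ q)))))
         (algebra (binom m (suc q + 0)) (binom m (q + 0)) (binom m 0) 1ℤ (pascal m (q + 0)) (trans (binom-0 (suc m)) (sym (binom-0 m)))))
  where
  lemma : ∀ a b c d → a ℤ.- c ℤ.+ d ℤ.+ b ≡ b ℤ.+ a ℤ.- c ℤ.+ d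
  lemma = solve-∀
  algebra : ∀ a b c d {e f} → e ≡ b ℤ.+ a → f ≡ c → a ℤ.- c ℤ.+ d ℤ.+ b ≡ e ℤ.- f ℤ.+ d
  algebra a b c d refl refl = lemma a b c d
diff-star-high (suc m) n q (suc j)
  rewrite ℕ.+-suc q j | ℕ.+-suc n m = trans
    (diff-times1+x (timesStar m (broomRank n q)) (q + j))
    (trans (cong₂ ℤ._+_ (trans (cong (diff (timesStar m (broomRank n q))) (sym (ℕ.+-suc q j)))
                               (diff-star-high m n q (suc j)))
                        (diff-star-high m n q j))
           (algebra (binom m (q + suc j)) (binom m (q + j)) (binom m (suc j)) (binom m j) (ballot (n + m) (suc j)) (ballot (n + m) j)
             (cong (binom m) (ℕ.+-suc q j)) (pascal m (q + j)) (pascal m j) (ballot-pascal (n + m) j)))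
  where
  lemma : ∀ a a′ b b′ c c′ → a ℤ.- b ℤ.+ c ℤ.+ (a′ ℤ.- b′ ℤ.+ c′) ≡ a′ ℤ.+ a ℤ.- (b′ ℤ.+ b) ℤ.+ (c ℤ.+ c′)
  lemma = solve-∀
  algebra : ∀ a a′ b b′ c c′ {a″ a‴ b″ c″} → a ≡ a‴ → a″ ≡ a′ ℤ.+ a‴ → b″ ≡ b′ ℤ.+ b → c″ ≡ c ℤ.+ c′ →
    a ℤ.- b ℤ.+ c ℤ.+ (a′ ℤ.- b′ ℤ.+ c′) ≡ a″ ℤ.- b″ ℤ.+ c″
  algebra a a′ b b′ c c′ refl refl refl refl = lemma a a′ b b′ c c′

module _ (m p n q : ℕ) where

  private
    d : ℕ → ℤ
    d = diff (mergeRank m p n q)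

  diff-mergeRank-low : ∀ {i} → i < p → d i ≡ + broomRank n q i
  diff-mergeRank-low = diff-timesBroom-low m p (broomRank n q)

  diff-mergeRank-middle : ∀ {j} → j < q → d (p + j) ≡ + broomRank n q (p + j) ℤ.- 1ℤ ℤ.+ binom m j
  diff-mergeRank-middle {j} j<q = trans (diff-timesBroom-high m p (broomRank n q) j)
    (cong₂ (λ x y → + broomRank n q (p + j) ℤ.- x ℤ.+ y) (broomRank-low n q j<q) (diff-star-low m n q j<q))

  diff-mergeRank-high : ∀ j → d (p + q + j) ≡ increment m p n q j
  diff-mergeRank-high j rewrite ℕ.+-assoc p q j = trans
    (diff-timesBroom-high m p (broomRank n q) (q + j))
    (trans (cong₂ ℤ._+_ (cong₂ ℤ._-_ (trans (cong (λ i → + broomRank n q i) (shuffle p q j)) (broomRank-high n q (p + j)))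
                                     (broomRank-high n q j))
                        (diff-star-high m n q j))
           (sym (ℤ.+-assoc (binom n (p + j) ℤ.- binom n j) _ _)))
    where
    shuffle : ∀ p q j → p + (q + j) ≡ q + (p + j)
    shuffle p q j = trans (sym (ℕ.+-assoc p q j)) (trans (cong (_+ j) (ℕ.+-comm p q)) (ℕ.+-assoc q p j))

-- Unimodality of the merge polynomials

signChange-shift : ∀ N {f} → (∀ {i} → i < N → 0ℤ ℤ.≤ f i) → SignChange (λ j → f (N + j)) → SignChange f
signChange-shift zero    _   sf = sf
signChange-shift (suc N) f≥0 sf = signChange-tail (f≥0 z<s) (signChange-shift N (f≥0 ∘ s≤s) sf)

-- The search descends from `N` to the last positive value. A negative value before it would
-- contradict the sign change.
signChange⇒peak : ∀ f N → SignChange f → (∀ {i} → N ≤ i → f i ℤ.≤ 0ℤ) →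
  ∃ λ K → (∀ {i} → i < K → 0ℤ ℤ.≤ f i) × (∀ {i} → K ≤ i → f i ℤ.≤ 0ℤ)
signChange⇒peak f zero    sf f≤0 = 0 , (λ ()) , f≤0
signChange⇒peak f (suc N) sf f≤0 with f N ℤ.≤? 0ℤ
... | no  fN≰0 = suc N , (λ { (s≤s i≤N) → ℤ.≮⇒≥ λ fi<0 → fN≰0 (sf i≤N fi<0) }) , f≤0
... | yes fN≤0 = signChange⇒peak f N sf λ N≤i → case (ℕ.m≤n⇒m<n∨m≡n N≤i)
  where
  case : ∀ {i} → N < i ⊎ N ≡ i → f i ℤ.≤ 0ℤ
  case (inj₁ N<i)  = f≤0 N<i
  case (inj₂ refl) = fN≤0

-- For positive `m` and `n`, the first three conditions say that `mn - m - n = (m - 1) (n - 1) - 1`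
-- is positive. The last two say that the increment at index 1 is negative.
NonUnimodalParameters : (m p n q : ℕ) → Set
NonUnimodalParameters m p n q = 2 ≤ m × 2 ≤ n × 5 ≤ m + n × n ≤ p × m ≤ q

nonUnimodalParameters? : ∀ m p n q → Dec (NonUnimodalParameters m p n q)
nonUnimodalParameters? m p n q =
  2 ≤? m ×-dec 2 ≤? n ×-dec 5 ≤? m + n ×-dec n ≤? p ×-dec m ≤? q

increment-0 : ∀ m p n q → increment m p n q 0 ≡ binom n p ℤ.+ binom m q ℤ.- 1ℤ
increment-0 m p n q rewrite ℕ.+-identityʳ p | ℕ.+-identityʳ q | binom-0 n | binom-0 m =
  lemma (binom n p) (binom m q)
  where
  lemma : ∀ a b → a ℤ.- 1ℤ ℤ.+ (b ℤ.- 1ℤ) ℤ.+ 1ℤ ≡ a ℤ.+ b ℤ.- 1ℤ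
  lemma = solve-∀

increment-1 : ∀ m p n q → increment m p n q 1 ≡ binom n (p + 1) ℤ.+ binom m (q + 1) ℤ.- 1ℤ
increment-1 m p n q rewrite binom-1 n | binom-1 m | binom-1 (n + m) | binom-0 (n + m) =
  lemma (binom n (p + 1)) (binom m (q + 1)) (+ n) (+ m)
  where
  lemma : ∀ a b x y → a ℤ.- x ℤ.+ (b ℤ.- y) ℤ.+ (x ℤ.+ y ℤ.- 1ℤ) ≡ a ℤ.+ b ℤ.- 1ℤ
  lemma = solve-∀

module _ {m p n q : ℕ} (n≤p : n ≤ p) (m≤q : m ≤ q) where

  binom-n-vanishes : ∀ j → binom n (p + suc j) ≡ 0ℤ
  binom-n-vanishes j = binom-vanishes (ℕ.≤-<-trans n≤p (ℕ.m<m+n p z<s))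

  binom-m-vanishes : ∀ j → binom m (q + suc j) ≡ 0ℤ
  binom-m-vanishes j = binom-vanishes (ℕ.≤-<-trans m≤q (ℕ.m<m+n q z<s))

  increment-1-negative : increment m p n q 1 ≡ -1ℤ
  increment-1-negative rewrite increment-1 m p n q | binom-n-vanishes 0 | binom-m-vanishes 0 = refl

  increment-2 : increment m p n q 2 ≡ + n ℤ.* + m ℤ.- (+ n ℤ.+ + m)
  increment-2
    rewrite binom-n-vanishes 1 | binom-m-vanishes 1 | binom-2-+ n m | binom-1 (n + m) =
    lemma (binom n 2) (binom m 2) (+ n) (+ m)
    where
    lemma : ∀ a b x y → 0ℤ ℤ.- a ℤ.+ (0ℤ ℤ.- b) ℤ.+ (a ℤ.+ b ℤ.+ x ℤ.* y ℤ.- (x ℤ.+ y)) ≡ x ℤ.* y ℤ.- (x ℤ.+ y)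
    lemma = solve-∀

increment-2-positive : ∀ {m p n q} → NonUnimodalParameters m p n q → 0ℤ ℤ.< increment m p n q 2
increment-2-positive {suc (suc a)} {p} {suc (suc b)} {q} (s≤s (s≤s _) , s≤s (s≤s _) , 5≤m+n , n≤p , m≤q) =
  -- In the excesses `a` and `b` over 2 the value is `ba + (a + b)`, and `5 ≤ m + n` makes `a + b`
  -- positive.
  subst (0ℤ ℤ.<_)
    (sym (trans (increment-2 n≤p m≤q) (trans (lemma (+ a) (+ b)) (cong (ℤ._+ + (a + b)) (sym (ℤ.pos-* b a))))))
    (ℤ.+<+ (ℕ.<-≤-trans (1≤a+b 5≤m+n) (ℕ.m≤n+m (a + b) (b * a))))
  where
  lemma : ∀ a b → (+ 2 ℤ.+ b) ℤ.* (+ 2 ℤ.+ a) ℤ.- (+ 2 ℤ.+ b ℤ.+ (+ 2 ℤ.+ a)) ≡ b ℤ.* a ℤ.+ (a ℤ.+ b)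
  lemma = solve-∀
  1≤a+b : 5 ≤ 2 + (a + (2 + b)) → 1 ≤ a + b
  1≤a+b h rewrite ℕ.+-suc a (suc b) | ℕ.+-suc a b with s≤s (s≤s (s≤s (s≤s h′))) ← h = h′

-- Past index `n + m`, only the subtracted binomial of the ballot number, one degree lower, can
-- survive.
increment-nonpos-far : ∀ m p n q {j} → n + m < j → increment m p n q j ℤ.≤ 0ℤ
increment-nonpos-far m p n q {suc j} n+m<j
  rewrite binom-vanishes n+m<j
        | binom-vanishes (ℕ.≤-<-trans (ℕ.m≤m+n n m) n+m<j)
        | binom-vanishes (ℕ.≤-<-trans (ℕ.m≤n+m m n) n+m<j)
        | binom-vanishes (ℕ.<-≤-trans (ℕ.≤-<-trans (ℕ.m≤m+n n m) n+m<j) (ℕ.m≤n+m (suc j) p))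
        | binom-vanishes (ℕ.<-≤-trans (ℕ.≤-<-trans (ℕ.m≤n+m m n) n+m<j) (ℕ.m≤n+m (suc j) q))
        | ℤ.+-identityˡ (0ℤ ℤ.- binom (n + m) j)
  = ℤ.i≤j⇒i-j≤0 (binom-nonneg (n + m) j)

-- One negative increment from index 2 on makes the later ones nonpositive. If `m` or `n` is 1, the
-- increment at 2 is -1; if both are 2, it is 0 and the next one is -2.
increment-nonpos : ∀ {m p n q} → 0 < m → 0 < n → n ≤ p → m ≤ q → ¬ NonUnimodalParameters m p n q →
  ∀ j → increment m p n q (2 + j) ℤ.≤ 0ℤ
increment-nonpos {m} {p} {n} {q} 0<m 0<n n≤p m≤q unbad = go m n 0<m 0<n refl refl
  where
  from-2 : increment m p n q 2 ≡ -1ℤ → ∀ j → increment m p n q (2 + j) ℤ.≤ 0ℤ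
  from-2 eq j = increment-signChange m p n q {0} {j} z≤n (subst (ℤ._< 0ℤ) (sym eq) ℤ.-<+)

  two-two : m ≡ 2 → n ≡ 2 → ∀ j → increment m p n q (2 + j) ℤ.≤ 0ℤ
  two-two refl refl zero = ℤ.≤-reflexive (increment-2 n≤p m≤q)
  two-two refl refl (suc j) =
    increment-signChange m p n q {1} {suc j} (s≤s z≤n) (subst (ℤ._< 0ℤ) (sym eq) ℤ.-<+)
    where
    eq : increment 2 p 2 q 3 ≡ ℤ.- + 2
    eq rewrite binom-n-vanishes {2} {p} {2} {q} n≤p m≤q 2 | binom-m-vanishes {2} {p} {2} {q} n≤p m≤q 2
             | binom-vanishes {2} {3} (s≤s ℕ.≤-refl) | ballot-4-3 = refl

  minus-one : ∀ a b → a ≡ 1 ⊎ b ≡ 1 → + b ℤ.* + a ℤ.- (+ b ℤ.+ + a) ≡ -1ℤ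
  minus-one a b (inj₁ refl) = lemma (+ b)
    where
    lemma : ∀ b → b ℤ.* 1ℤ ℤ.- (b ℤ.+ 1ℤ) ≡ -1ℤ
    lemma = solve-∀
  minus-one a b (inj₂ refl) = lemma (+ a)
    where
    lemma : ∀ a → 1ℤ ℤ.* a ℤ.- (1ℤ ℤ.+ a) ≡ -1ℤ
    lemma = solve-∀

  go : ∀ a b → 0 < a → 0 < b → m ≡ a → n ≡ b → ∀ j → increment m p n q (2 + j) ℤ.≤ 0ℤ
  go 1 b _ _ refl refl = from-2 (trans (increment-2 n≤p m≤q) (minus-one m n (inj₁ refl)))
  go (suc (suc a)) 1 _ _ refl refl = from-2 (trans (increment-2 n≤p m≤q) (minus-one m n (inj₂ refl)))
  go 2 2 _ _ refl refl = two-two refl refl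
  go 2 (suc (suc (suc b))) _ _ refl refl =
    contradiction (s≤s (s≤s z≤n) , s≤s (s≤s z≤n) , s≤s (s≤s (s≤s (s≤s (s≤s z≤n)))) , n≤p , m≤q) unbad
  go (suc (suc (suc a))) (suc (suc b)) _ _ refl refl =
    contradiction (s≤s (s≤s z≤n) , s≤s (s≤s z≤n) ,
      s≤s (s≤s (s≤s (ℕ.≤-trans (s≤s (s≤s z≤n)) (ℕ.m≤n+m (2 + b) a)))) , n≤p , m≤q) unbad

-- Restores the factor `x` that accounts for the root. The value at index 0 is a filler.
fromIndex1 : (ℕ → ℕ) → ℕ → ℕ
fromIndex1 f zero    = 0
fromIndex1 f (suc i) = f i

module _ (m p n q : ℕ) where

  private
    a d : ℕ → ℤ
    a = λ i → + broomRank n q i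
    d = diff (mergeRank m p n q)

    locate : ∀ k i → i < k ⊎ ∃ λ j → i ≡ k + j
    locate k i with i <? k
    ... | yes i<k = inj₁ i<k
    ... | no  i≮k with j , refl ← ℕ.m≤n⇒∃[o]m+o≡n (ℕ.≮⇒≥ i≮k) = inj₂ (j , refl)

    a-nonneg : ∀ i → 0ℤ ℤ.≤ a i
    a-nonneg i = ℤ.+≤+ z≤n

    -- The only negative contribution in the middle range is -1, so one positive summand outweighs
    -- it.
    d-middle-nonneg : ∀ {j} → j < q → 1ℤ ℤ.≤ a (p + j) ⊎ 1ℤ ℤ.≤ binom m j → 0ℤ ℤ.≤ d (p + j)
    d-middle-nonneg {j} j<q h = subst (0ℤ ℤ.≤_)
      (trans (lemma (a (p + j)) (binom m j)) (sym (diff-mergeRank-middle m p n q j<q)))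
      (ℤ.i≤j⇒0≤j-i (sum≥1 h))
      where
      lemma : ∀ x y → x ℤ.+ y ℤ.- 1ℤ ≡ x ℤ.- 1ℤ ℤ.+ y
      lemma = solve-∀
      sum≥1 : 1ℤ ℤ.≤ a (p + j) ⊎ 1ℤ ℤ.≤ binom m j → 1ℤ ℤ.≤ a (p + j) ℤ.+ binom m j
      sum≥1 (inj₁ h) = ℤ.+-mono-≤ h (binom-nonneg m j)
      sum≥1 (inj₂ h) = ℤ.+-mono-≤ (a-nonneg (p + j)) h

    increment-signChange-from :
      0ℤ ℤ.≤ d (p + q + 0) → 0ℤ ℤ.≤ d (p + q + 1) → SignChange (λ j → d (p + q + j))
    increment-signChange-from h₀ h₁ = signChange-tail h₀ (signChange-tail h₁
      (signChange-cong (λ j → sym (diff-mergeRank-high m p n q (2 + j))) (increment-signChange m p n q)))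

  -- If one path is short, some binomial or path coefficient is positive at every middle index and
  -- in the increments at 0 and 1. Hence nothing is negative before index 2, where
  -- `increment-signChange` takes over.
  signChange-short-path : p < n ⊎ q < m → SignChange d
  signChange-short-path short = signChange-shift (p + q) low
    (increment-signChange-from
      (subst (0ℤ ℤ.≤_) (sym (trans (diff-mergeRank-high m p n q 0) (increment-0 m p n q)))
        (≥1 p q (positive₀ short)))
      (subst (0ℤ ℤ.≤_) (sym (trans (diff-mergeRank-high m p n q 1) (increment-1 m p n q)))
        (≥1 (p + 1) (q + 1) (positive₁ short))))
    where
    ≥1 : ∀ x y → 1ℤ ℤ.≤ binom n x ⊎ 1ℤ ℤ.≤ binom m y → 0ℤ ℤ.≤ binom n x ℤ.+ binom m y ℤ.- 1ℤ
    ≥1 x y (inj₁ h) = ℤ.i≤j⇒0≤j-i (ℤ.+-mono-≤ h (binom-nonneg m y))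
    ≥1 x y (inj₂ h) = ℤ.i≤j⇒0≤j-i (ℤ.+-mono-≤ (binom-nonneg n x) h)

    positive₀ : p < n ⊎ q < m → 1ℤ ℤ.≤ binom n p ⊎ 1ℤ ℤ.≤ binom m q
    positive₀ (inj₁ p<n) = inj₁ (binom-positive (ℕ.<⇒≤ p<n))
    positive₀ (inj₂ q<m) = inj₂ (binom-positive (ℕ.<⇒≤ q<m))

    positive₁ : p < n ⊎ q < m → 1ℤ ℤ.≤ binom n (p + 1) ⊎ 1ℤ ℤ.≤ binom m (q + 1)
    positive₁ (inj₁ p<n) = inj₁ (binom-positive (subst (_≤ n) (ℕ.+-comm 1 p) p<n))
    positive₁ (inj₂ q<m) = inj₂ (binom-positive (subst (_≤ m) (ℕ.+-comm 1 q) q<m))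

    middle : p < n ⊎ q < m → ∀ {j} → j < q → 1ℤ ℤ.≤ a (p + j) ⊎ 1ℤ ℤ.≤ binom m j
    middle (inj₂ q<m) j<q = inj₂ (binom-positive (ℕ.<⇒≤ (ℕ.<-trans j<q q<m)))
    middle (inj₁ p<n) {j} j<q with locate q (p + j)
    ... | inj₁ p+j<q = inj₁ (ℤ.≤-reflexive (sym (broomRank-low n q p+j<q)))
    ... | inj₂ (l , p+j≡q+l) = inj₁ (subst (1ℤ ℤ.≤_)
            (sym (trans (cong a p+j≡q+l) (broomRank-high n q l)))
            (binom-positive (ℕ.<⇒≤ (ℕ.<-trans l<p p<n))))
      where
      open ℕ.≤-Reasoning
      l<p : l < p
      l<p = ℕ.+-cancelˡ-< q l p (begin-strict
        q + l  ≡⟨ p+j≡q+l ⟨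
        p + j  <⟨ ℕ.+-monoʳ-< p j<q ⟩
        p + q  ≡⟨ ℕ.+-comm p q ⟩
        q + p  ∎)

    low : ∀ {i} → i < p + q → 0ℤ ℤ.≤ d i
    low {i} i<p+q with locate p i
    ... | inj₁ i<p        = subst (0ℤ ℤ.≤_) (sym (diff-mergeRank-low m p n q i<p)) (a-nonneg i)
    ... | inj₂ (j , refl) = let j<q = ℕ.+-cancelˡ-< p j q i<p+q in d-middle-nonneg j<q (middle short j<q)

  private
    -- A middle difference is two natural numbers minus 1, so it is negative only if both vanish,
    -- which happens past the degree `n + q` of `A_{n,q}` and past `p + m`. From there on the middle
    -- differences equal -1.
    past : ∀ {i} → i < p + q → d i ℤ.< 0ℤ → n + q < i × p + m < i
    past {i} i<p+q di<0 with locate p i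
    ... | inj₁ i<p = contradiction (subst (ℤ._< 0ℤ) (diff-mergeRank-low m p n q i<p) di<0) (ℤ.≤⇒≯ (a-nonneg i))
    ... | inj₂ (l , refl) =
        ℕ.≰⇒> (λ h → ℤ.<⇒≱ di<0 (d-middle-nonneg l<q (inj₁ (a-positive h))))
      , ℕ.≰⇒> (λ h → ℤ.<⇒≱ di<0 (d-middle-nonneg l<q (inj₂ (binom-positive (ℕ.+-cancelˡ-≤ p l m h)))))
      where
      l<q = ℕ.+-cancelˡ-< p l q i<p+q
      a-positive : p + l ≤ n + q → 1ℤ ℤ.≤ a (p + l)
      a-positive h with locate q (p + l)
      ... | inj₁ p+l<q    = ℤ.≤-reflexive (sym (broomRank-low n q p+l<q))
      ... | inj₂ (k , eq) = subst (1ℤ ℤ.≤_) (sym (trans (cong a eq) (broomRank-high n q k)))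
              (binom-positive (ℕ.+-cancelˡ-≤ q k n (subst₂ _≤_ eq (ℕ.+-comm n q) h)))

    past-nonpos : ∀ {j} → j < p + q → n + q < j → p + m < j → d j ℤ.≤ 0ℤ
    past-nonpos {j} j<p+q n+q<j p+m<j with locate p j
    ... | inj₁ j<p        = contradiction (ℕ.<-trans j<p (ℕ.≤-<-trans (ℕ.m≤m+n p m) p+m<j)) (ℕ.<-irrefl refl)
    ... | inj₂ (l , refl) with locate q (p + l)
    ...   | inj₁ p+l<q = contradiction (ℕ.<-trans p+l<q (ℕ.≤-<-trans (ℕ.m≤n+m q n) n+q<j)) (ℕ.<-irrefl refl)
    ...   | inj₂ (k , eq) = subst (ℤ._≤ 0ℤ) (sym (trans (diff-mergeRank-middle m p n q (ℕ.+-cancelˡ-< p l q j<p+q))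
              (cong₂ (λ x y → x ℤ.- 1ℤ ℤ.+ y)
                (trans (cong a eq) (trans (broomRank-high n q k)
                  (binom-vanishes (ℕ.+-cancelˡ-< q n k (subst₂ _<_ (ℕ.+-comm n q) eq n+q<j)))))
                (binom-vanishes (ℕ.+-cancelˡ-< p m l p+m<j))))) ℤ.-≤+

  signChange-long-paths : n ≤ p → m ≤ q → (∀ j → increment m p n q (2 + j) ℤ.≤ 0ℤ) → SignChange d
  signChange-long-paths n≤p m≤q inc≤0 {i} {j} i≤j di<0 = case (locate (p + q) j) (ℕ.m≤n⇒m<n∨m≡n i≤j)
    where
    case : (j < p + q ⊎ ∃ λ l → j ≡ p + q + l) → i < j ⊎ i ≡ j → d j ℤ.≤ 0ℤ
    case _ (inj₂ refl) = ℤ.<⇒≤ di<0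
    case (inj₁ j<p+q) (inj₁ i<j) =
      let n+q<i , p+m<i = past (ℕ.<-trans i<j j<p+q) di<0 in
      past-nonpos j<p+q (ℕ.<-trans n+q<i i<j) (ℕ.<-trans p+m<i i<j)
    -- Since `i` exceeds `n + q` and `p + m` but not `p + q`, the inequalities `n < p` and `m < q`
    -- are strict. So both binomials in the increment at 0 vanish.
    case (inj₂ (zero , refl)) (inj₁ i<p+q+0) =
      let i<p+q = subst (i <_) (ℕ.+-identityʳ (p + q)) i<p+q+0
          n+q<i , p+m<i = past i<p+q di<0
          n<p = ℕ.+-cancelʳ-< q n p (ℕ.<-trans n+q<i i<p+q)
          m<q = ℕ.+-cancelˡ-< p m q (ℕ.<-trans p+m<i i<p+q)
      in subst (ℤ._≤ 0ℤ)
           (sym (trans (diff-mergeRank-high m p n q 0) (trans (increment-0 m p n q)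
             (cong₂ (λ x y → x ℤ.+ y ℤ.- 1ℤ) (binom-vanishes n<p) (binom-vanishes m<q)))))
           ℤ.-≤+
    case (inj₂ (suc zero , refl)) _ = subst (ℤ._≤ 0ℤ)
      (sym (trans (diff-mergeRank-high m p n q 1) (increment-1-negative n≤p m≤q))) ℤ.-≤+
    case (inj₂ (suc (suc l) , refl)) _ =
      subst (ℤ._≤ 0ℤ) (sym (diff-mergeRank-high m p n q (2 + l))) (inc≤0 l)

  mergeRank-signChange : 0 < m → 0 < n → ¬ NonUnimodalParameters m p n q → SignChange d
  mergeRank-signChange 0<m 0<n unbad with p <? n | q <? m
  ... | yes p<n | _       = signChange-short-path (inj₁ p<n)
  ... | no  _   | yes q<m = signChange-short-path (inj₂ q<m)
  ... | no  p≮n | no  q≮m = let n≤p = ℕ.≮⇒≥ p≮n ; m≤q = ℕ.≮⇒≥ q≮m in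
    signChange-long-paths n≤p m≤q (increment-nonpos 0<m 0<n n≤p m≤q unbad)

  private
    far : ∀ {i} → p + q + (n + m) ≤ i → d (suc i) ℤ.≤ 0ℤ
    far {i} h with l , refl ← ℕ.m≤n⇒∃[o]m+o≡n h = subst (ℤ._≤ 0ℤ)
      (trans (sym (diff-mergeRank-high m p n q (suc (n + m + l))))
        (cong d (trans (ℕ.+-suc (p + q) _) (cong suc (sym (ℕ.+-assoc (p + q) (n + m) l))))))
      (increment-nonpos-far m p n q (s≤s (ℕ.m≤m+n (n + m) l)))

  mergeRank-unimodal : 0 < m → 0 < n → ¬ NonUnimodalParameters m p n q → Unimodal (fromIndex1 (mergeRank m p n q))
  mergeRank-unimodal 0<m 0<n unbad
    -- `d 0` is no step between two ranks, so the peak is sought in `d` from index 1 on.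
    with K , up , down ← signChange⇒peak (λ i → d (suc i)) (p + q + (n + m))
           (λ i≤j → mergeRank-signChange 0<m 0<n unbad (s≤s i≤j)) far
    = suc K , s≤s z≤n
    , (λ { (suc i) _ (s≤s i<K) → ℤ.drop‿+≤+ (ℤ.0≤i-j⇒j≤i (up i<K)) })
    , (λ { (suc i) (s≤s K≤i) → ℤ.drop‿+≤+ (ℤ.i-j≤0⇒i≤j (down K≤i)) })

  -- The sequence falls from rank `p + q + 1` to the next one and then rises. A peak beyond rank
  -- `p + q + 1` contradicts the fall, any other peak the rise.
  mergeRank-not-unimodal : NonUnimodalParameters m p n q →
    ∀ {r} → (∀ i → r (suc i) ≡ mergeRank m p n q i) → ¬ Unimodal r
  mergeRank-not-unimodal bad@(_ , _ , _ , n≤p , m≤q) {r} r≡ (suc K , _ , up , down) with K ≤? p + q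
  ... | no K≰p+q = contradiction
    (ℤ.i≤j⇒0≤j-i (ℤ.+≤+ (subst₂ _≤_ (r≡ (p + q)) (r≡ (suc (p + q))) (up (suc (p + q)) (s≤s z≤n) (s≤s (ℕ.≰⇒> K≰p+q))))))
    (ℤ.<⇒≱ (subst (ℤ._< 0ℤ)
      (sym (trans (cong d (sym (ℕ.+-comm (p + q) 1))) (trans (diff-mergeRank-high m p n q 1) (increment-1-negative n≤p m≤q))))
      ℤ.-<+))
  ... | yes K≤p+q = contradiction
    (ℤ.i≤j⇒i-j≤0 (ℤ.+≤+ (subst₂ _≤_ (r≡ (2 + (p + q))) (r≡ (1 + (p + q))) (down (2 + (p + q)) (s≤s (ℕ.m≤n⇒m≤1+n K≤p+q))))))
    (ℤ.<⇒≱ (subst (0ℤ ℤ.<_)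
      (sym (trans (cong d (sym (ℕ.+-comm (p + q) 2))) (diff-mergeRank-high m p n q 2)))
      (increment-2-positive bad)))

-- Cardinalities

private
  variable
    a b c ℓ₁ ℓ₂ ℓ₃ : Level

module _ (S : Setoid a ℓ₁) (T : Setoid b ℓ₂) where
  open Setoid S using () renaming (Carrier to A; _≈_ to _≈₁_)
  open Setoid T using (trans) renaming (Carrier to B; _≈_ to _≈₂_; sym to ≈-sym)

  HasCardinality-map : (f : A → B) → (∀ {x y} → x ≈₁ y → f x ≈₂ f y) → (∀ {x y} → f x ≈₂ f y → x ≈₁ y) →
    (∀ y → ∃ λ x → f x ≈₂ y) → ∀ {n} → HasCardinality S n → HasCardinality T n
  HasCardinality-map f f-cong f-inj f-surj (xs , xs! , _∈xs , refl) =
    List.map f xs , Unique.map⁺ S T f-inj xs!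
    , (λ y → let x , fx≈y = f-surj y in Membershipₚ.∈-resp-≈ T fx≈y (Membershipₚ.∈-map⁺ S T f-cong (x ∈xs)))
    , length-map f xs

module _ (S : Setoid a ℓ₁) (T : Setoid b ℓ₂) (U : Setoid c ℓ₃) where
  open Setoid S using () renaming (Carrier to A; _≈_ to _≈₁_)
  open Setoid T using () renaming (Carrier to B; _≈_ to _≈₂_)
  open Setoid U using () renaming (Carrier to D; _≈_ to _≈₃_; trans to ≈-trans; sym to ≈-sym)

  HasCardinality-+ : (f : A → D) (g : B → D) →
    (∀ {x y} → x ≈₁ y → f x ≈₃ f y) → (∀ {x y} → f x ≈₃ f y → x ≈₁ y) →
    (∀ {x y} → x ≈₂ y → g x ≈₃ g y) → (∀ {x y} → g x ≈₃ g y → x ≈₂ y) →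
    (∀ {x y} → ¬ f x ≈₃ g y) → (∀ z → (∃ λ x → f x ≈₃ z) ⊎ (∃ λ y → g y ≈₃ z)) →
    ∀ {m n} → HasCardinality S m → HasCardinality T n → HasCardinality U (m + n)
  HasCardinality-+ f g f-cong f-inj g-cong g-inj f≉g cover (xs , xs! , _∈xs , refl) (ys , ys! , _∈ys , refl) =
    List.map f xs List.++ List.map g ys
    , Unique.++⁺ U (Unique.map⁺ S U f-inj xs!) (Unique.map⁺ T U g-inj ys!) disjoint
    , enumerates
    , trans (length-++ (List.map f xs)) (cong₂ _+_ (length-map f xs) (length-map g ys))
    where
    disjoint : ∀ {z} → ¬ (Membership._∈_ U z (List.map f xs) × Membership._∈_ U z (List.map g ys))
    disjoint (z∈fxs , z∈gys) with Membershipₚ.∈-map⁻ S U z∈fxs | Membershipₚ.∈-map⁻ T U z∈gys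
    ... | _ , _ , z≈fx | _ , _ , z≈gy = f≉g (≈-trans (≈-sym z≈fx) z≈gy)

    enumerates : ∀ z → Membership._∈_ U z (List.map f xs List.++ List.map g ys)
    enumerates z with cover z
    ... | inj₁ (x , fx≈z) =
      Membershipₚ.∈-++⁺ˡ U (Membershipₚ.∈-resp-≈ U fx≈z (Membershipₚ.∈-map⁺ S U f-cong (x ∈xs)))
    ... | inj₂ (y , gy≈z) =
      Membershipₚ.∈-++⁺ʳ U (List.map f xs) (Membershipₚ.∈-resp-≈ U gy≈z (Membershipₚ.∈-map⁺ T U g-cong (y ∈ys)))

module _ (S : Setoid a ℓ₁) where
  open Setoid S using (Carrier; _≈_)

  HasCardinality-0 : ¬ Carrier → HasCardinality S 0
  HasCardinality-0 empty = [] , [] , (λ x → contradiction x empty) , refl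

  HasCardinality-1 : (x : Carrier) → (∀ y → y ≈ x) → HasCardinality S 1
  HasCardinality-1 x all = List.[ x ] , (All.[] ∷ []) , (λ y → here (all y)) , refl

  private
    lookup-injective : ∀ {xs} → Unique S xs → ∀ i j → List.lookup xs i ≈ List.lookup xs j → i ≡ j
    lookup-injective (_ ∷ _)    Fin.zero    Fin.zero    _ = refl
    lookup-injective (x∉ ∷ _)   Fin.zero    (Fin.suc j) e = contradiction e (All.lookup x∉ (∈-lookup j))
    lookup-injective (x∉ ∷ _)   (Fin.suc i) Fin.zero    e = contradiction (Setoid.sym S e) (All.lookup x∉ (∈-lookup i))
    lookup-injective (_ ∷ xs!)  (Fin.suc i) (Fin.suc j) e = cong Fin.suc (lookup-injective xs! i j e)

  -- Refuting `RankUnimodal` means comparing an arbitrary rank sequence with the computed one.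
  -- Sending an entry of one list to the position of its equivalent in the other is injective, and
  -- this works in both directions.
  HasCardinality-unique : ∀ {m n} → HasCardinality S m → HasCardinality S n → m ≡ n
  HasCardinality-unique (xs , xs! , _∈xs , refl) (ys , ys! , _∈ys , refl) =
    ℕ.≤-antisym (injection xs! _∈ys) (injection ys! _∈xs)
    where
    injection : ∀ {xs ys} → Unique S xs → (∀ x → Membership._∈_ S x ys) → List.length xs ≤ List.length ys
    injection {xs} xs! _∈ys = injective⇒≤ {f = λ i → index (List.lookup xs i ∈ys)} λ {i} {j} e →
      lookup-injective xs! i j (Membershipₚ.index-injective S (List.lookup xs i ∈ys) (List.lookup xs j ∈ys) e)

-- Weighted sets

level : {A : Set} → (A → ℕ) → ℕ → Setoid 0ℓ 0ℓ
level {A} w i = On.setoid {B = ∃ λ x → w x ≡ i} (setoid A) proj₁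

-- `f` is the generating function of the weight `w`, as a coefficient sequence.
HasCounts : {A : Set} → (A → ℕ) → (ℕ → ℕ) → Set
HasCounts w f = ∀ i → HasCardinality (level w i) (f i)

-- Encodes a rooted subtree by following the path: `nothing` stops at the current vertex, `just`
-- takes the next path vertex, and at the end any set of pendant vertices may be chosen. The
-- recursion is that of `timesBroom`.
BroomSubset : (m p : ℕ) → Set
BroomSubset m zero    = Subset m
BroomSubset m (suc p) = Maybe (BroomSubset m p)

size : ∀ m p → BroomSubset m p → ℕ
size m zero    v        = ∣ v ∣
size m (suc p) nothing  = 0
size m (suc p) (just x) = suc (size m p x)

δ-counts : HasCounts {⊤} (λ _ → 0) δ
δ-counts zero    = HasCardinality-1 (level _ 0) (tt , refl) λ _ → refl
δ-counts (suc i) = HasCardinality-0 (level _ (suc i)) λ ()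

module _ {A : Set} (w : A → ℕ) where

  weight : ∀ m p → BroomSubset m p × A → ℕ
  weight m p (x , a) = size m p x + w a

  -- Each factor `1 + x` is the choice whether to include one pendant vertex.
  timesStar-counts : ∀ m {f} → HasCounts w f → HasCounts (weight m 0) (timesStar m f)
  timesStar-counts zero    c i = HasCardinality-map (level w i) (level (weight 0 0) i)
    (λ (a , e) → ([] , a) , e) (cong ([] ,_)) (cong proj₂) (λ { (([] , a) , e) → (a , e) , refl }) (c i)
  timesStar-counts (suc m) c zero = HasCardinality-map (level (weight m 0) 0) (level (weight (suc m) 0) 0)
    (λ ((v , a) , e) → (outside ∷ v , a) , e) (λ { refl → refl }) (λ { refl → refl })
    (λ { ((outside ∷ v , a) , e) → ((v , a) , e) , refl ; ((inside ∷ v , a) , ()) })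
    (timesStar-counts m c zero)
  timesStar-counts (suc m) c (suc i) = HasCardinality-+
    (level (weight m 0) (suc i)) (level (weight m 0) i) (level (weight (suc m) 0) (suc i))
    (λ ((v , a) , e) → (outside ∷ v , a) , e)
    (λ ((v , a) , e) → (inside ∷ v , a) , cong suc e)
    (λ { refl → refl }) (λ { refl → refl }) (λ { refl → refl }) (λ { refl → refl })
    (λ ())
    (λ { ((outside ∷ v , a) , e) → inj₁ (((v , a) , e) , refl)
       ; ((inside ∷ v , a) , e) → inj₂ (((v , a) , ℕ.suc-injective e) , refl) })
    (timesStar-counts m c (suc i)) (timesStar-counts m c i)

  -- The recursion `A_{m,p+1} = 1 + x A_{m,p}` is the choice between `nothing` and `just`.
  timesBroom-counts : ∀ m p {f} → HasCounts w f → HasCounts (weight m p) (timesBroom m p f)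
  timesBroom-counts m zero    c i       = timesStar-counts m c i
  timesBroom-counts m (suc p) c zero    = HasCardinality-map (level w 0) (level (weight m (suc p)) 0)
    (λ (a , e) → (nothing , a) , e) (λ { refl → refl }) (λ { refl → refl })
    (λ { ((nothing , a) , e) → (a , e) , refl ; ((just _ , _) , ()) })
    (c zero)
  timesBroom-counts m (suc p) c (suc i) = HasCardinality-+
    (level w (suc i)) (level (weight m p) i) (level (weight m (suc p)) (suc i))
    (λ (a , e) → (nothing , a) , e)
    (λ ((x , a) , e) → (just x , a) , cong suc e)
    (λ { refl → refl }) (λ { refl → refl }) (λ { refl → refl }) (λ { refl → refl })
    (λ ())
    (λ { ((nothing , a) , e) → inj₁ ((a , e) , refl)
       ; ((just x , a) , e) → inj₂ (((x , a) , ℕ.suc-injective e) , refl) })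
    (c (suc i)) (timesBroom-counts m p c i)

-- The factor `⊤` carries the generating function `δ`, to which the two broom factors are applied.
MergeSubset : (m p n q : ℕ) → Set
MergeSubset m p n q = BroomSubset m p × BroomSubset n q × ⊤

mergeSize : ∀ m p n q → MergeSubset m p n q → ℕ
mergeSize m p n q (x , y , _) = size m p x + (size n q y + 0)

mergeRank-counts : ∀ m p n q → HasCounts (mergeSize m p n q) (mergeRank m p n q)
mergeRank-counts m p n q = timesBroom-counts _ m p (timesBroom-counts _ n q δ-counts)

open RootedTree

-- Rooted subtrees as parent-closed sets

parent-unique : ∀ T {u u′ v} → _⟶_ T u v → _⟶_ T u′ v → u ≡ u′
parent-unique T (j , refl , refl) (.j , refl , refl) = refl

module _ (T : RootedTree) where

  ParentClosed : Subset (order T) → Set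
  ParentClosed S = ∀ j → suc j ∈ S → parent T j ∈ S

  module _ {S : Subset (order T)} where

    path-in-closed : ParentClosed S → ∀ {u v} → Star (_⟶_ T) u v → v ∈ S → u ∈ S × EqClosure (InducedEdge T S) u v
    path-in-closed closed ε v∈S = v∈S , ε
    path-in-closed closed ((j , refl , refl) ◅ path) v∈S =
      let w∈S , w~v = path-in-closed closed path v∈S
          u∈S = closed j w∈S
      in u∈S , fwd (u∈S , w∈S , j , refl , refl) ◅ w~v

    -- Two vertices are joined via the root, along the tree paths to them, which closedness keeps
    -- inside `S`.
    closed⇒connected : ParentClosed S → Connected T S
    closed⇒connected closed {u} {v} u∈S v∈S = EqClosure.transitive _
      (EqClosure.symmetric _ (proj₂ (path-in-closed closed (reachable T u) u∈S)))
      (proj₂ (path-in-closed closed (reachable T v) v∈S))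

    -- A path from suc j to the root has to leave the descendants of suc j, which is
    -- only possible through parent j.
    connected⇒closed : root T ∈ S → Connected T S → ParentClosed S
    connected⇒closed root∈S connected j j∈S = leave (connected j∈S root∈S) ε
      where
      leave : ∀ {w} → EqClosure (InducedEdge T S) w (root T) → Star (flip (_⟶_ T)) w (suc j) → parent T j ∈ S
      leave ε ((_ , _ , ()) ◅ _)
      leave (fwd (_ , _ , e) ◅ path) desc = leave path (e ◅ desc)
      leave (bwd (w∈S , _ , e) ◅ path) ε = subst (_∈ S) (parent-unique T e (j , refl , refl)) w∈S
      leave (bwd (_ , _ , e) ◅ path) (e′ ◅ desc) rewrite parent-unique T e e′ = leave path desc

-- Rooted subtrees of merged brooms

∈-++⁺ˡ : ∀ {m n} {xs : Subset m} {ys : Subset n} {i} → i ∈ xs → i ↑ˡ n ∈ xs ++ ys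
∈-++⁺ˡ here        = here
∈-++⁺ˡ (there i∈) = there (∈-++⁺ˡ i∈)

∈-++⁻ˡ : ∀ {m n} {xs : Subset m} {ys : Subset n} {i} → i ↑ˡ n ∈ xs ++ ys → i ∈ xs
∈-++⁻ˡ {xs = _ ∷ _} {i = zero}  here       = here
∈-++⁻ˡ {xs = _ ∷ _} {i = suc _} (there i∈) = there (∈-++⁻ˡ i∈)

∈-++⁺ʳ : ∀ {m n} (xs : Subset m) {ys : Subset n} {i} → i ∈ ys → m ↑ʳ i ∈ xs ++ ys
∈-++⁺ʳ []       i∈ = i∈
∈-++⁺ʳ (_ ∷ xs) i∈ = there (∈-++⁺ʳ xs i∈)

∈-++⁻ʳ : ∀ {m n} (xs : Subset m) {ys : Subset n} {i} → m ↑ʳ i ∈ xs ++ ys → i ∈ ys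
∈-++⁻ʳ []       i∈         = i∈
∈-++⁻ʳ (_ ∷ xs) (there i∈) = ∈-++⁻ʳ xs i∈

∣++∣ : ∀ {m n} (xs : Subset m) (ys : Subset n) → ∣ xs ++ ys ∣ ≡ ∣ xs ∣ + ∣ ys ∣
∣++∣ []             ys = refl
∣++∣ (inside ∷ xs)  ys = cong suc (∣++∣ xs ys)
∣++∣ (outside ∷ xs) ys = ∣++∣ xs ys

data SplitView {m n : ℕ} : Fin (m + n) → Set where
  left  : ∀ i → SplitView (i ↑ˡ n)
  right : ∀ i → SplitView (m ↑ʳ i)

splitView : ∀ m {n} (i : Fin (m + n)) → SplitView {m} i
splitView zero    i       = right i
splitView (suc m) zero    = left zero
splitView (suc m) (suc i) with splitView m i
... | left j  = left (suc j)
... | right j = right j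

broomParent-suc : ∀ m p j → broomParent m (suc p) (suc j) ≡ suc (broomParent m p j)
broomParent-suc m p j with splitAt p j
... | inj₁ _ = refl
... | inj₂ _ = refl

toSubset : ∀ m p → BroomSubset m p → Subset (p + m)
toSubset m zero    v        = v
toSubset m (suc p) nothing  = ⊥
toSubset m (suc p) (just x) = inside ∷ toSubset m p x

toSubset-size : ∀ m p x → ∣ toSubset m p x ∣ ≡ size m p x
toSubset-size m zero    v        = refl
toSubset-size m (suc p) nothing  = ∣⊥∣≡0 (p + m)
toSubset-size m (suc p) (just x) = cong suc (toSubset-size m p x)

toSubset-injective : ∀ m p {x y} → toSubset m p x ≡ toSubset m p y → x ≡ y
toSubset-injective m zero    e = e
toSubset-injective m (suc p) {nothing} {nothing} e = refl
toSubset-injective m (suc p) {just x}  {just y}  e = cong just (toSubset-injective m p (∷-injectiveʳ e))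

toSubset-closed : ∀ m p x → ParentClosed (broom m p) (inside ∷ toSubset m p x)
toSubset-closed m zero    v        j       _          = here
toSubset-closed m (suc p) nothing  j       (there j∈) = contradiction j∈ ∉⊥
toSubset-closed m (suc p) (just x) zero    _          = here
toSubset-closed m (suc p) (just x) (suc j) (there j∈) rewrite broomParent-suc m p j =
  there (toSubset-closed m p x j j∈)

closed⇒toSubset : ∀ m p v → ParentClosed (broom m p) (inside ∷ v) → ∃ λ x → toSubset m p x ≡ v
closed⇒toSubset m zero    v            closed = v , refl
closed⇒toSubset m (suc p) (outside ∷ v) closed = nothing , cong (outside ∷_) (sym (Empty-unique empty))
  where
  -- The missing path vertex is the root of the shorter broom. Any element of `v` would, through its
  -- path from that root, force the root into the closed set.
  closed′ : ParentClosed (broom m p) (outside ∷ v)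
  closed′ j j∈ with i∈ ← closed (suc j) (there j∈) rewrite broomParent-suc m p j = drop-there i∈
  empty : ¬ ∃ λ i → i ∈ v
  empty (i , i∈) with () ← proj₁ (path-in-closed (broom m p) closed′ (reachable (broom m p) (suc i)) (there i∈))
closed⇒toSubset m (suc p) (inside ∷ v) closed =
  let x , e = closed⇒toSubset m p v closed′ in just x , cong (inside ∷_) e
  where
  closed′ : ParentClosed (broom m p) (inside ∷ v)
  closed′ j j∈ with i∈ ← closed (suc j) (there j∈) rewrite broomParent-suc m p j = drop-there i∈

module _ (T U : RootedTree) where

  mergeParent-↑ˡ : ∀ i → mergeParent T U (i ↑ˡ edges U) ≡ mergeˡ T U (parent T i)
  mergeParent-↑ˡ i rewrite splitAt-↑ˡ (edges T) i (edges U) = refl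

  mergeParent-↑ʳ : ∀ i → mergeParent T U (edges T ↑ʳ i) ≡ mergeʳ T U (parent U i)
  mergeParent-↑ʳ i rewrite splitAt-↑ʳ (edges T) (edges U) i = refl

  module _ {xs : Subset (edges T)} {ys : Subset (edges U)} where

    mergeʳ-∈⁺ : ∀ {v} → v ∈ inside ∷ ys → mergeʳ T U v ∈ inside ∷ xs ++ ys
    mergeʳ-∈⁺ {zero}  _          = here
    mergeʳ-∈⁺ {suc _} (there v∈) = there (∈-++⁺ʳ xs v∈)

    mergeʳ-∈⁻ : ∀ {v} → mergeʳ T U v ∈ inside ∷ xs ++ ys → v ∈ inside ∷ ys
    mergeʳ-∈⁻ {zero}  _          = here
    mergeʳ-∈⁻ {suc _} (there v∈) = there (∈-++⁻ʳ xs v∈)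

    merge-closed⁺ : ParentClosed T (inside ∷ xs) → ParentClosed U (inside ∷ ys) →
      ParentClosed (T · U) (inside ∷ xs ++ ys)
    merge-closed⁺ closedT closedU j j∈ with splitView (edges T) j
    ... | left i  rewrite mergeParent-↑ˡ i = ∈-++⁺ˡ {ys = ys} (closedT i (∈-++⁻ˡ {ys = ys} j∈))
    ... | right i rewrite mergeParent-↑ʳ i = mergeʳ-∈⁺ (closedU i (mergeʳ-∈⁻ j∈))

    merge-closed⁻ˡ : ParentClosed (T · U) (inside ∷ xs ++ ys) → ParentClosed T (inside ∷ xs)
    merge-closed⁻ˡ closed i i∈ = ∈-++⁻ˡ {ys = ys}
      (subst (_∈ inside ∷ xs ++ ys) (mergeParent-↑ˡ i) (closed (i ↑ˡ edges U) (∈-++⁺ˡ {ys = ys} i∈)))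

    merge-closed⁻ʳ : ParentClosed (T · U) (inside ∷ xs ++ ys) → ParentClosed U (inside ∷ ys)
    merge-closed⁻ʳ closed i i∈ = mergeʳ-∈⁻
      (subst (_∈ inside ∷ xs ++ ys) (mergeParent-↑ʳ i) (closed (edges T ↑ʳ i) (mergeʳ-∈⁺ i∈)))

module _ (m p n q : ℕ) where

  private
    T U : RootedTree
    T = broom m p
    U = broom n q

  mergeToSubset : MergeSubset m p n q → Subset (order (T · U))
  mergeToSubset (x , y , _) = inside ∷ toSubset m p x ++ toSubset n q y

  mergeToSubset-injective : ∀ {s t} → mergeToSubset s ≡ mergeToSubset t → s ≡ t
  mergeToSubset-injective {x , y , _} {x′ , y′ , _} e =
    let e₁ , e₂ = ++-injective (toSubset m p x) (toSubset m p x′) (∷-injectiveʳ e)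
    in cong₂ (λ x y → x , y , tt) (toSubset-injective m p e₁) (toSubset-injective n q e₂)

  mergeToSubset-size : ∀ s → ∣ mergeToSubset s ∣ ≡ suc (mergeSize m p n q s)
  mergeToSubset-size (x , y , _) = cong suc (trans (∣++∣ (toSubset m p x) (toSubset n q y))
    (cong₂ _+_ (toSubset-size m p x) (trans (toSubset-size n q y) (sym (ℕ.+-identityʳ _)))))

  mergeToSubset-surjective : ((S , _) : RootedSubtree (T · U)) → ∃ λ s → mergeToSubset s ≡ S
  mergeToSubset-surjective (inside ∷ S , here , connected) with Vec.splitAt (edges T) S
  ... | xs , ys , refl =
    let closed = connected⇒closed (T · U) here connected
        x , x≡ = closed⇒toSubset m p xs (merge-closed⁻ˡ T U closed)
        y , y≡ = closed⇒toSubset n q ys (merge-closed⁻ʳ T U {xs} closed)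
    in (x , y , tt) , cong₂ (λ xs ys → inside ∷ xs ++ ys) x≡ y≡

  merge-rankSequence : IsRankSequence (T · U) (fromIndex1 (mergeRank m p n q))
  merge-rankSequence (suc i) _ = HasCardinality-map (level (mergeSize m p n q) i) (rankSetoid (T · U) (suc i))
    (λ (s , e) → (mergeToSubset s , here , closed⇒connected (T · U) (closed s)) , trans (mergeToSubset-size s) (cong suc e))
    (cong mergeToSubset)
    mergeToSubset-injective
    (λ (S , e) → let s , s≡ = mergeToSubset-surjective S in
      (s , ℕ.suc-injective (trans (sym (mergeToSubset-size s)) (trans (cong ∣_∣ s≡) e))) , s≡)
    (mergeRank-counts m p n q i)
    where
    closed : ∀ s → ParentClosed (T · U) (mergeToSubset s)
    closed (x , y , _) = merge-closed⁺ T U (toSubset-closed m p x) (toSubset-closed n q y)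

-- Invariance under isomorphism

private
  module ℕ-Sum = Sum ℕ.+-0-commutativeMonoid

  indicator : Bool → ℕ
  indicator b = if b then 1 else 0

  -- As a sum over all vertices, the size is invariant under bijections of the vertices, which
  -- `preimage-size` exploits.
  ∣∣≡sum : ∀ {n} (S : Subset n) → ∣ S ∣ ≡ ℕ-Sum.sum (indicator ∘ lookup S)
  ∣∣≡sum []            = refl
  ∣∣≡sum (inside ∷ S)  = cong suc (∣∣≡sum S)
  ∣∣≡sum (outside ∷ S) = ∣∣≡sum S

module _ {T U : RootedTree} (f : T ≅ U) where
  open _≅_ f

  preimage : Subset (order U) → Subset (order T)
  preimage S = tabulate (lookup S ∘ to)

  preimage⁺ : ∀ {S v} → to v ∈ S → v ∈ preimage S
  preimage⁺ {S} {v} v∈ = lookup⇒[]= v (preimage S) (trans (lookup∘tabulate (lookup S ∘ to) v) ([]=⇒lookup v∈))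

  preimage⁻ : ∀ {S v} → v ∈ preimage S → to v ∈ S
  preimage⁻ {S} {v} v∈ = lookup⇒[]= (to v) S (trans (sym (lookup∘tabulate (lookup S ∘ to) v)) ([]=⇒lookup v∈))

  preimage-size : ∀ S → ∣ preimage S ∣ ≡ ∣ S ∣
  preimage-size S = begin
    ∣ preimage S ∣                                     ≡⟨ ∣∣≡sum (preimage S) ⟩
    ℕ-Sum.sum (indicator ∘ lookup (preimage S))        ≡⟨ ℕ-Sum.sum-cong-≗ (λ v → cong indicator (lookup∘tabulate (lookup S ∘ to) v)) ⟩
    ℕ-Sum.sum (indicator ∘ lookup S ∘ to)              ≡⟨ ℕ-Sum.sum-permute (indicator ∘ lookup S) bijection ⟨
    ℕ-Sum.sum (indicator ∘ lookup S)                   ≡⟨ ∣∣≡sum S ⟨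
    ∣ S ∣                                              ∎
    where open ≡-Reasoning

  preimage-connected : ∀ {S} → Connected U S → Connected T (preimage S)
  preimage-connected {S} connected {u} {v} u∈ v∈ =
    subst₂ (EqClosure (InducedEdge T (preimage S))) (strictlyInverseʳ u) (strictlyInverseʳ v)
      (EqClosure.gmap from induced (connected (preimage⁻ u∈) (preimage⁻ v∈)))
    where
    induced : ∀ {u v} → InducedEdge U S u v → InducedEdge T (preimage S) (from u) (from v)
    induced {u} {v} (u∈ , v∈ , e) =
        preimage⁺ (subst (_∈ S) (sym (strictlyInverseˡ u)) u∈)
      , preimage⁺ (subst (_∈ S) (sym (strictlyInverseˡ v)) v∈)
      , Equivalence.from (edge-preserving (from u) (from v))
          (subst₂ (_⟶_ U) (sym (strictlyInverseˡ u)) (sym (strictlyInverseˡ v)) e)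

  preimage-subtree : RootedSubtree U → RootedSubtree T
  preimage-subtree (S , root∈ , connected) =
    preimage S , preimage⁺ (subst (_∈ S) (sym root-preserving) root∈) , preimage-connected connected

preimage-inverse : ∀ {T U} (f : T ≅ U) S → preimage (≅-sym f) (preimage f S) ≡ S
preimage-inverse f S = trans
  (tabulate-cong λ v → trans (lookup∘tabulate (lookup S ∘ to) (from v)) (cong (lookup S) (strictlyInverseˡ v)))
  (tabulate∘lookup S)
  where open _≅_ f

≅-rankSequence : ∀ {T U r} → T ≅ U → IsRankSequence U r → IsRankSequence T r
≅-rankSequence {T} {U} f rank i 1≤i = HasCardinality-map (rankSetoid U i) (rankSetoid T i)
  (λ (S , e) → preimage-subtree f S , trans (preimage-size f (proj₁ S)) e)
  (cong (preimage f))
  (λ {(S , _)} {(S′ , _)} e → trans (sym (preimage-inverse f (proj₁ S)))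
    (trans (cong (preimage (≅-sym f)) e) (preimage-inverse f (proj₁ S′))))
  (λ (S , e) → (preimage-subtree (≅-sym f) S , trans (preimage-size (≅-sym f) (proj₁ S)) e)
             , preimage-inverse (≅-sym f) (proj₁ S))
  (rank i 1≤i)

≅-rankUnimodal : ∀ {T U} → T ≅ U → RankUnimodal U → RankUnimodal T
≅-rankUnimodal f (r , rank , unimodal) = r , ≅-rankSequence f rank , unimodal

-- Rank unimodality of merges of brooms

merge-rankUnimodal : ∀ {m p n q} → 0 < m → 0 < n → ¬ NonUnimodalParameters m p n q →
  RankUnimodal (broom m p · broom n q)
merge-rankUnimodal {m} {p} {n} {q} 0<m 0<n unbad =
  fromIndex1 (mergeRank m p n q) , merge-rankSequence m p n q , mergeRank-unimodal m p n q 0<m 0<n unbad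

merge-not-rankUnimodal : ∀ {m p n q} → NonUnimodalParameters m p n q → ¬ RankUnimodal (broom m p · broom n q)
merge-not-rankUnimodal {m} {p} {n} {q} bad (r , rank , unimodal) = mergeRank-not-unimodal m p n q bad
  (λ i → HasCardinality-unique (rankSetoid (broom m p · broom n q) (suc i))
    (rank (suc i) (s≤s z≤n)) (merge-rankSequence m p n q (suc i) (s≤s z≤n)))
  unimodal

-- Commutativity of the merge

module _ (T U : RootedTree) where

  swapVertex : Vertex (T · U) → Vertex (U · T)
  swapVertex zero    = zero
  swapVertex (suc j) = suc (join (edges U) (edges T) (swap (splitAt (edges T) j)))

  swap-mergeˡ : ∀ v → swapVertex (mergeˡ T U v) ≡ mergeʳ U T v
  swap-mergeˡ zero = refl
  swap-mergeˡ (suc i) rewrite splitAt-↑ˡ (edges T) i (edges U) = refl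

  swap-mergeʳ : ∀ v → swapVertex (mergeʳ T U v) ≡ mergeˡ U T v
  swap-mergeʳ zero = refl
  swap-mergeʳ (suc i) rewrite splitAt-↑ʳ (edges T) (edges U) i = refl

  edge-mergeˡ : ∀ {u v} → _⟶_ T u v → _⟶_ (T · U) (mergeˡ T U u) (mergeˡ T U v)
  edge-mergeˡ (j , refl , refl) = j ↑ˡ edges U , mergeParent-↑ˡ T U j , refl

  edge-mergeʳ : ∀ {u v} → _⟶_ U u v → _⟶_ (T · U) (mergeʳ T U u) (mergeʳ T U v)
  edge-mergeʳ (j , refl , refl) = edges T ↑ʳ j , mergeParent-↑ʳ T U j , refl

module _ (T U : RootedTree) where

  swap-involutive : ∀ v → swapVertex U T (swapVertex T U v) ≡ v
  swap-involutive zero = refl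
  swap-involutive (suc j) with splitView (edges T) j
  ... | left i  = trans (cong (swapVertex U T) (swap-mergeˡ T U (suc i))) (swap-mergeʳ U T (suc i))
  ... | right i = trans (cong (swapVertex U T) (swap-mergeʳ T U (suc i))) (swap-mergeˡ U T (suc i))

  swap-edge : ∀ {u v} → _⟶_ (T · U) u v → _⟶_ (U · T) (swapVertex T U u) (swapVertex T U v)
  swap-edge (j , refl , refl) with splitView (edges T) j
  ... | left i  = subst₂ (_⟶_ (U · T))
    (trans (sym (swap-mergeˡ T U (parent T i))) (cong (swapVertex T U) (sym (mergeParent-↑ˡ T U i))))
    (sym (swap-mergeˡ T U (suc i)))
    (edge-mergeʳ U T (i , refl , refl))
  ... | right i = subst₂ (_⟶_ (U · T))
    (trans (sym (swap-mergeʳ T U (parent U i))) (cong (swapVertex T U) (sym (mergeParent-↑ʳ T U i))))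
    (sym (swap-mergeʳ T U (suc i)))
    (edge-mergeˡ U T (i , refl , refl))

·-comm : ∀ T U → T · U ≅ U · T
·-comm T U = record
  { bijection       = mk↔ₛ′ (swapVertex T U) (swapVertex U T) (swap-involutive U T) (swap-involutive T U)
  ; root-preserving = refl
  ; edge-preserving = λ u v → mk⇔ (swap-edge T U)
      (subst₂ (_⟶_ (T · U)) (swap-involutive T U u) (swap-involutive T U v) ∘ swap-edge U T)
  }

-- Depth and number of children of a vertex

module _ (T : RootedTree) where

  data Depth : ℕ → Vertex T → Set where
    at-root : Depth 0 (root T)
    below   : ∀ {d u v} → Depth d u → _⟶_ T u v → Depth (suc d) v

  depth-unique : ∀ {d e v} → Depth d v → Depth e v → d ≡ e
  depth-unique at-root     at-root     = refl
  depth-unique at-root     (below _ (_ , _ , ()))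
  depth-unique (below _ (_ , _ , ())) at-root
  depth-unique (below x u⟶v) (below y u′⟶v) rewrite parent-unique T u⟶v u′⟶v = cong suc (depth-unique x y)

  Children : Vertex T → ℕ → Set
  Children v k = ∃ λ (c : Fin k → Vertex T) →
    (∀ {i j} → c i ≡ c j → i ≡ j) × (∀ i → _⟶_ T v (c i)) × (∀ {w} → _⟶_ T v w → ∃ λ i → c i ≡ w)

  children-≤ : ∀ {v k l} → Children v k → Children v l → k ≤ l
  children-≤ (c , c-inj , child , _) (c′ , _ , _ , cover) = injective⇒≤ {f = λ i → proj₁ (cover (child i))}
    λ {i} {j} e → c-inj (trans (sym (proj₂ (cover (child i)))) (trans (cong c′ e) (proj₂ (cover (child j)))))

  children-unique : ∀ {v k l} → Children v k → Children v l → k ≡ l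
  children-unique x y = ℕ.≤-antisym (children-≤ x y) (children-≤ y x)

  AtMostOneChild : Vertex T → Set
  AtMostOneChild v = ∀ {w w′} → _⟶_ T v w → _⟶_ T v w′ → w ≡ w′

  atMostOneChild : ∀ {v k} → AtMostOneChild v → Children v k → k ≤ 1
  atMostOneChild {k = zero}        _   _ = z≤n
  atMostOneChild {k = suc zero}    _   _ = s≤s z≤n
  atMostOneChild {k = suc (suc _)} one (c , c-inj , child , _)
    with () ← c-inj {zero} {suc zero} (one (child zero) (child (suc zero)))

  -- An isomorphism invariant: in a merge of brooms, only the ends of the two paths can be hubs with
  -- `d > 0` and `k ≥ 2`, and they reveal the pairs of path length and star size.
  Hub : ℕ → ℕ → Set
  Hub d k = ∃ λ v → Depth d v × Children v k

module _ {T U : RootedTree} (f : T ≅ U) where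
  open _≅_ f

  private
    edge⁺ : ∀ {u v} → _⟶_ T u v → _⟶_ U (to u) (to v)
    edge⁺ {u} {v} = Equivalence.to (edge-preserving u v)

  ≅-depth : ∀ {d v} → Depth T d v → Depth U d (to v)
  ≅-depth at-root     = subst (Depth U 0) (sym root-preserving) at-root
  ≅-depth (below x e) = below (≅-depth x) (edge⁺ e)

  ≅-children : ∀ {v k} → Children T v k → Children U (to v) k
  ≅-children {v} (c , c-inj , child , cover) =
    to ∘ c
    , (λ {i} {j} e → c-inj (trans (sym (strictlyInverseʳ (c i))) (trans (cong from e) (strictlyInverseʳ (c j)))))
    , edge⁺ ∘ child
    , λ {w} v⟶w → let i , ci≡ = cover (Equivalence.from (edge-preserving v (from w))
                                         (subst (_⟶_ U (to v)) (sym (strictlyInverseˡ w)) v⟶w))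
                  in i , trans (cong to ci≡) (strictlyInverseˡ w)

  ≅-hub : ∀ {d k} → Hub T d k → Hub U d k
  ≅-hub (v , depth , children) = to v , ≅-depth depth , ≅-children children

-- The parameters of a merge of brooms are determined by its isomorphism class

module _ (m : ℕ) where

  broom-suc-edge⁺ : ∀ p {u v} → _⟶_ (broom m p) u v → _⟶_ (broom m (suc p)) (suc u) (suc v)
  broom-suc-edge⁺ p (j , refl , refl) = suc j , broomParent-suc m p j , refl

  broom-suc-edge⁻ : ∀ p {u w} → _⟶_ (broom m (suc p)) (suc u) w → ∃ λ v → w ≡ suc v × _⟶_ (broom m p) u v
  broom-suc-edge⁻ p (suc j , e , refl) =
    suc j , refl , j , suc-injective (trans (sym (broomParent-suc m p j)) e) , refl

  broom-suc-depth : ∀ p {d v} → Depth (broom m p) d v → Depth (broom m (suc p)) (suc d) (suc v)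
  broom-suc-depth p at-root     = below at-root (zero , refl , refl)
  broom-suc-depth p (below x e) = below (broom-suc-depth p x) (broom-suc-edge⁺ p e)

  broom-suc-children : ∀ p {v k} → Children (broom m p) v k → Children (broom m (suc p)) (suc v) k
  broom-suc-children p (c , c-inj , child , cover) =
    suc ∘ c , c-inj ∘ suc-injective , broom-suc-edge⁺ p ∘ child
    , λ e → let v , w≡ , e′ = broom-suc-edge⁻ p e ; i , ci≡ = cover e′ in i , trans (cong suc ci≡) (sym w≡)

  broom-vertex : ∀ p v → AtMostOneChild (broom m p) v ⊎ (Depth (broom m p) p v × Children (broom m p) v m)
  broom-vertex zero    zero    = inj₂ (at-root , suc , suc-injective , (λ i → i , refl , refl) , λ (j , _ , e) → j , e)
  broom-vertex zero    (suc i) = inj₁ λ { (_ , () , _) _ }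
  broom-vertex (suc p) zero    = inj₁ only-child
    where
    only-child : AtMostOneChild (broom m (suc p)) zero
    only-child (zero , _ , refl) (zero , _ , refl) = refl
    only-child (suc j , e , _)   _ with () ← trans (sym (broomParent-suc m p j)) e
    only-child _ (suc j , e , _) with () ← trans (sym (broomParent-suc m p j)) e
  broom-vertex (suc p) (suc v) with broom-vertex p v
  ... | inj₂ (depth , children) = inj₂ (broom-suc-depth p depth , broom-suc-children p children)
  ... | inj₁ one = inj₁ λ e₁ e₂ →
    let v₁ , w₁≡ , e₁′ = broom-suc-edge⁻ p e₁
        v₂ , w₂≡ , e₂′ = broom-suc-edge⁻ p e₂
    in trans w₁≡ (trans (cong suc (one e₁′ e₂′)) (sym w₂≡))

  broom-hub : ∀ p → Hub (broom m p) p m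
  broom-hub zero    = zero , at-root , suc , suc-injective , (λ i → i , refl , refl) , λ (j , _ , e) → j , e
  broom-hub (suc p) = let v , depth , children = broom-hub p in
    suc v , broom-suc-depth p depth , broom-suc-children p children

↑ˡ≢↑ʳ : ∀ {a b} {i : Fin a} {j : Fin b} → ¬ i ↑ˡ b ≡ a ↑ʳ j
↑ˡ≢↑ʳ {a} {b} {i} {j} e with () ← trans (sym (splitAt-↑ˡ a i b)) (trans (cong (splitAt a) e) (splitAt-↑ʳ a b j))

module _ (T U : RootedTree) where

  mergeˡ-depth : ∀ {d v} → Depth T d v → Depth (T · U) d (mergeˡ T U v)
  mergeˡ-depth at-root     = at-root
  mergeˡ-depth (below x e) = below (mergeˡ-depth x) (edge-mergeˡ T U e)

  -- Restricted to nonroot vertices, because the merged root also has the root's children in `U`.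
  mergeˡ-edge⁻ : ∀ {i w} → _⟶_ (T · U) (mergeˡ T U (suc i)) w → ∃ λ v → w ≡ mergeˡ T U v × _⟶_ T (suc i) v
  mergeˡ-edge⁻ {i} (j , e , refl) with splitView (edges T) j
  ... | left j′  = suc j′ , refl , j′ , ↑ˡ-injective (edges U) _ _ (trans (sym (mergeParent-↑ˡ T U j′)) e) , refl
  ... | right j′ with parent U j′ | mergeParent-↑ʳ T U j′
  ...   | zero  | e′ with () ← trans (sym e′) e
  ...   | suc _ | e′ = contradiction (sym (suc-injective (trans (sym e′) e))) ↑ˡ≢↑ʳ

  mergeˡ-children : ∀ {i k} → Children T (suc i) k → Children (T · U) (mergeˡ T U (suc i)) k
  mergeˡ-children (c , c-inj , child , cover) =
    mergeˡ T U ∘ c , c-inj ∘ ↑ˡ-injective (edges U) _ _ , edge-mergeˡ T U ∘ child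
    , λ e → let v , w≡ , e′ = mergeˡ-edge⁻ e ; i , ci≡ = cover e′ in i , trans (cong (mergeˡ T U) ci≡) (sym w≡)

  mergeˡ-atMostOneChild : ∀ {i} → AtMostOneChild T (suc i) → AtMostOneChild (T · U) (mergeˡ T U (suc i))
  mergeˡ-atMostOneChild one e₁ e₂ =
    let v₁ , w₁≡ , e₁′ = mergeˡ-edge⁻ e₁
        v₂ , w₂≡ , e₂′ = mergeˡ-edge⁻ e₂
    in trans w₁≡ (trans (cong (mergeˡ T U) (one e₁′ e₂′)) (sym w₂≡))

module _ (m p n q : ℕ) where

  private
    T U : RootedTree
    T = broom m p
    U = broom n q

  merge-hub : 0 < p → Hub (T · U) p m
  merge-hub 0<p with broom-hub m p
  ... | zero  , at-root , _ with () ← 0<p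
  ... | suc i , depth , children = mergeˡ T U (suc i) , mergeˡ-depth T U depth , mergeˡ-children T U children

  mergeˡ-hub-unique : ∀ {d i k} → Depth (T · U) d (mergeˡ T U (suc i)) → Children (T · U) (mergeˡ T U (suc i)) k →
    2 ≤ k → d ≡ p × k ≡ m
  mergeˡ-hub-unique {i = i} depth children 2≤k with broom-vertex m p (suc i)
  ... | inj₁ one = contradiction (atMostOneChild (T · U) (mergeˡ-atMostOneChild T U one) children) (ℕ.<⇒≱ 2≤k)
  ... | inj₂ (depth′ , children′) = depth-unique (T · U) depth (mergeˡ-depth T U depth′)
                                  , children-unique (T · U) children (mergeˡ-children T U children′)

-- The condition `0 < d` sets aside the merged root, where children from both brooms meet. Vertices
-- of the right broom are treated by swapping the factors.
merge-hub-unique : ∀ m p n q {d k} → Hub (broom m p · broom n q) d k → 0 < d → 2 ≤ k →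
  (d ≡ p × k ≡ m) ⊎ (d ≡ q × k ≡ n)
merge-hub-unique m p n q (zero , depth , _) 0<d _ with depth-unique (broom m p · broom n q) depth at-root
... | refl with () ← 0<d
merge-hub-unique m p n q {d} {k} (suc j , depth , children) _ 2≤k with splitView (p + m) j
... | left i  = inj₁ (mergeˡ-hub-unique m p n q depth children 2≤k)
... | right i = inj₂ (mergeˡ-hub-unique n q m p
  (subst (Depth (U · T) d) swap≡ (≅-depth (·-comm T U) depth))
  (subst (λ v → Children (U · T) v k) swap≡ (≅-children (·-comm T U) children))
  2≤k)
  where
  T = broom m p
  U = broom n q
  swap≡ = swap-mergeʳ T U (suc i)

module _ {m p n q m′ p′ n′ q′ : ℕ} where

  merge-parameters : NonUnimodalParameters m p n q → NonUnimodalParameters m′ p′ n′ q′ →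
    broom m p · broom n q ≅ broom m′ p′ · broom n′ q′ →
    (m ≡ m′ × p ≡ p′ × n ≡ n′ × q ≡ q′) ⊎ (m ≡ n′ × p ≡ q′ × n ≡ m′ × q ≡ p′)
  merge-parameters (2≤m , 2≤n , _ , n≤p , m≤q) (2≤m′ , 2≤n′ , _ , n′≤p′ , m′≤q′) f =
    match
      (merge-hub-unique m′ p′ n′ q′ (≅-hub f (merge-hub m p n q 0<p)) 0<p 2≤m)
      (merge-hub-unique m′ p′ n′ q′ (≅-hub f (≅-hub (·-comm (broom n q) (broom m p)) (merge-hub n q m p 0<q))) 0<q 2≤n)
      (merge-hub-unique m p n q (≅-hub (≅-sym f) (merge-hub m′ p′ n′ q′ 0<p′)) 0<p′ 2≤m′)
      (merge-hub-unique m p n q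
        (≅-hub (≅-sym f) (≅-hub (·-comm (broom n′ q′) (broom m′ p′)) (merge-hub n′ q′ m′ p′ 0<q′))) 0<q′ 2≤n′)
    where
    positive : ∀ {a b} → 2 ≤ a → a ≤ b → 0 < b
    positive 2≤a a≤b = ℕ.≤-trans (s≤s z≤n) (ℕ.≤-trans 2≤a a≤b)
    0<p  = positive 2≤n n≤p
    0<q  = positive 2≤m m≤q
    0<p′ = positive 2≤n′ n′≤p′
    0<q′ = positive 2≤m′ m′≤q′
    match : (p ≡ p′ × m ≡ m′) ⊎ (p ≡ q′ × m ≡ n′) → (q ≡ p′ × n ≡ m′) ⊎ (q ≡ q′ × n ≡ n′) →
      (p′ ≡ p × m′ ≡ m) ⊎ (p′ ≡ q × m′ ≡ n) → (q′ ≡ p × n′ ≡ m) ⊎ (q′ ≡ q × n′ ≡ n) →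
      (m ≡ m′ × p ≡ p′ × n ≡ n′ × q ≡ q′) ⊎ (m ≡ n′ × p ≡ q′ × n ≡ m′ × q ≡ p′)
    match (inj₁ (refl , refl)) (inj₂ (refl , refl)) _ _ = inj₁ (refl , refl , refl , refl)
    match (inj₂ (refl , refl)) (inj₁ (refl , refl)) _ _ = inj₂ (refl , refl , refl , refl)
    -- Hubs carry no multiplicity, so both pairs of one tree may match the same pair of the other.
    -- The reverse matching then shows that the remaining pair coincides with them too.
    match (inj₁ (refl , refl)) (inj₁ (refl , refl)) _ (inj₁ (refl , refl)) = inj₁ (refl , refl , refl , refl)
    match (inj₁ (refl , refl)) (inj₁ (refl , refl)) _ (inj₂ (refl , refl)) = inj₁ (refl , refl , refl , refl)
    match (inj₂ (refl , refl)) (inj₂ (refl , refl)) (inj₁ (refl , refl)) _ = inj₂ (refl , refl , refl , refl)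
    match (inj₂ (refl , refl)) (inj₂ (refl , refl)) (inj₂ (refl , refl)) _ = inj₂ (refl , refl , refl , refl)

-- Generating functions of weighted sums

module _ {A : Set} {w : A → ℕ} {f : ℕ → ℕ} where

  -- g is the product of f with 1 / (1 - x^s)
  geometric-counts : ∀ s {g} → 0 < s → (∀ {i} → i < s → g i ≡ f i) → (∀ i → g (s + i) ≡ f (s + i) + g i) →
    HasCounts w f → HasCounts (λ (x , a) → s * x + w a) g
  geometric-counts s {g} 0<s low high c = <-rec (λ i → HasCardinality (level W i) (g i)) step
    where
    W : ℕ × A → ℕ
    W (x , a) = s * x + w a

    zero≡ : ∀ {a i} → w a ≡ i → W (0 , a) ≡ i
    zero≡ {a} e = trans (cong (λ t → t + w a) (ℕ.*-zeroʳ s)) e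

    suc≡ : ∀ x a → W (suc x , a) ≡ s + W (x , a)
    suc≡ x a = trans (cong (λ t → t + w a) (ℕ.*-suc s x)) (ℕ.+-assoc s (s * x) (w a))

    step : ∀ i → (∀ {j} → j < i → HasCardinality (level W j) (g j)) → HasCardinality (level W i) (g i)
    step i rec with i <? s
    ... | yes i<s = subst (HasCardinality (level W i)) (sym (low i<s)) (HasCardinality-map (level w i) (level W i)
      (λ (a , e) → (0 , a) , zero≡ e) (cong (0 ,_)) (cong proj₂)
      (λ { ((zero , a) , e) → (a , trans (sym (zero≡ refl)) e) , refl
         ; ((suc x , a) , e) → contradiction i<s (ℕ.≤⇒≯ (ℕ.≤-trans (ℕ.m≤m+n s _) (ℕ.≤-reflexive (trans (sym (suc≡ x a)) e)))) })
      (c i))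
    ... | no i≮s with j , refl ← ℕ.m≤n⇒∃[o]m+o≡n (ℕ.≮⇒≥ i≮s) =
      subst (HasCardinality (level W (s + j))) (sym (high j))
        (HasCardinality-+ (level w (s + j)) (level W j) (level W (s + j))
          (λ (a , e) → (0 , a) , zero≡ e)
          (λ ((x , a) , e) → (suc x , a) , trans (suc≡ x a) (cong (_+_ s) e))
          (λ { refl → refl }) (λ { refl → refl }) (λ { refl → refl }) (λ { refl → refl })
          (λ ())
          (λ { ((zero , a) , e) → inj₁ ((a , trans (sym (zero≡ refl)) e) , refl)
             ; ((suc x , a) , e) → inj₂ (((x , a) , ℕ.+-cancelˡ-≡ s _ _ (trans (sym (suc≡ x a)) e)) , refl) })
          (c (s + j)) (rec (ℕ.m<n+m j 0<s)))

-- Multiplication by `x^k`.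
delay : ℕ → (ℕ → ℕ) → ℕ → ℕ
delay zero    f i       = f i
delay (suc k) f zero    = 0
delay (suc k) f (suc i) = delay k f i

delay-counts : ∀ {A : Set} {w : A → ℕ} {f} k → HasCounts w f → HasCounts (λ x → k + w x) (delay k f)
delay-counts zero c i = c i
delay-counts {w = w} (suc k) c zero = HasCardinality-0 (level (λ x → suc k + w x) 0) λ ()
delay-counts {w = w} (suc k) c (suc i) = HasCardinality-map (level (λ x → k + w x) i) (level (λ x → suc k + w x) (suc i))
  (λ (x , e) → x , cong suc e) (λ e → e) (λ e → e) (λ (x , e) → (x , ℕ.suc-injective e) , refl) (delay-counts k c i)

-- The expansions of 1 / (1 - x) (1 - x^2), of 1 / (1 - x) (1 - x^2) (1 - x^4) and of
-- 1 / (1 - x)^2 (1 - x^2) (1 - x^4).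
parts₁₂ parts₁₂₄ parts₁₁₂₄ : ℕ → ℕ
parts₁₂ 0             = 1
parts₁₂ 1             = 1
parts₁₂ (suc (suc i)) = 1 + parts₁₂ i

parts₁₂₄ 0 = parts₁₂ 0
parts₁₂₄ 1 = parts₁₂ 1
parts₁₂₄ 2 = parts₁₂ 2
parts₁₂₄ 3 = parts₁₂ 3
parts₁₂₄ (suc (suc (suc (suc i)))) = parts₁₂ (4 + i) + parts₁₂₄ i

parts₁₁₂₄ zero    = parts₁₂₄ 0
parts₁₁₂₄ (suc i) = parts₁₂₄ (suc i) + parts₁₁₂₄ i

Diagonal OffDiagonal : Set
Diagonal    = ℕ × ℕ × ℕ × ⊤
OffDiagonal = ℕ × Diagonal

-- Each coefficient is the number of vertices gained per unit: `a` lengthens both paths and enlarges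
-- both stars, `b` lengthens both paths, `c` lengthens one. The unsimplified shape is the one that
-- iterating `geometric-counts` produces.
diagonalWeight : Diagonal → ℕ
diagonalWeight (a , b , c , _) = 4 * a + (2 * b + (1 * c + 0))

offDiagonalWeight : OffDiagonal → ℕ
offDiagonalWeight (d , x) = 1 * d + diagonalWeight x

diagonal-counts : HasCounts diagonalWeight parts₁₂₄
diagonal-counts =
  geometric-counts 4 z<s
    (λ { {0} _ → refl ; {1} _ → refl ; {2} _ → refl ; {3} _ → refl ; {suc (suc (suc (suc _)))} (s≤s (s≤s (s≤s (s≤s ())))) })
    (λ _ → refl)
  (geometric-counts 2 {parts₁₂} z<s (λ { {0} _ → refl ; {1} _ → refl ; {suc (suc _)} (s≤s (s≤s ())) }) (λ _ → refl)
  (geometric-counts 1 {λ _ → 1} z<s (λ { {0} _ → refl ; {suc _} (s≤s ()) }) (λ _ → refl)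
  δ-counts))

offDiagonal-counts : HasCounts offDiagonalWeight parts₁₁₂₄
offDiagonal-counts = geometric-counts 1 z<s (λ { {0} _ → refl ; {suc _} (s≤s ()) }) (λ _ → refl) diagonal-counts

-- Representatives of the isomorphism classes: a merge of broom m p and broom n q
-- with m < n and arbitrary p ≥ n and q ≥ m, or with m = n and p ≤ q.
offDiagonalTree : OffDiagonal → RootedTree
offDiagonalTree (d , a , b , c , _) = broom m (n + c) · broom n (m + d)
  where
  m = 2 + a
  n = 3 + a + b

diagonalTree : Diagonal → RootedTree
diagonalTree (a , b , c , _) = broom n (n + b) · broom n (n + (b + c))
  where n = 3 + a

offDiagonal-order : ∀ x → order (offDiagonalTree x) ≡ 11 + offDiagonalWeight x
offDiagonal-order (d , a , b , c , _) = lemma d a b c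
  where
  lemma : ∀ d a b c → 1 + ((3 + a + b + c + (2 + a)) + (2 + a + d + (3 + a + b))) ≡
    11 + (1 * d + (4 * a + (2 * b + (1 * c + 0))))
  lemma = ℕ.solve-∀

diagonal-order : ∀ x → order (diagonalTree x) ≡ 13 + diagonalWeight x
diagonal-order (a , b , c , _) = lemma a b c
  where
  lemma : ∀ a b c → 1 + ((3 + a + b + (3 + a)) + (3 + a + (b + c) + (3 + a))) ≡ 13 + (4 * a + (2 * b + (1 * c + 0)))
  lemma = ℕ.solve-∀

offDiagonal-parameters : ∀ d a b c → NonUnimodalParameters (2 + a) (3 + a + b + c) (3 + a + b) (2 + a + d)
offDiagonal-parameters d a b c =
  s≤s (s≤s z≤n) , s≤s (s≤s z≤n)
  , s≤s (s≤s (ℕ.≤-trans (s≤s (s≤s (s≤s z≤n))) (ℕ.m≤n+m (3 + a + b) a)))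
  , ℕ.m≤m+n (3 + a + b) c , ℕ.m≤m+n (2 + a) d

diagonal-parameters : ∀ a b c → NonUnimodalParameters (3 + a) (3 + a + b) (3 + a) (3 + a + c)
diagonal-parameters a b c =
  s≤s (s≤s z≤n) , s≤s (s≤s z≤n)
  , s≤s (s≤s (s≤s (ℕ.≤-trans (s≤s (s≤s z≤n)) (ℕ.m≤n+m (3 + a) a))))
  , ℕ.m≤m+n (3 + a) b , ℕ.m≤m+n (3 + a) c

offDiagonal-injective : ∀ x y → offDiagonalTree x ≅ offDiagonalTree y → x ≡ y
offDiagonal-injective (d , a , b , c , _) (d′ , a′ , b′ , c′ , _) f =
  equal (merge-parameters (offDiagonal-parameters d a b c) (offDiagonal-parameters d′ a′ b′ c′) f)
  where
  equal : (2 + a ≡ 2 + a′ × 3 + a + b + c ≡ 3 + a′ + b′ + c′ × 3 + a + b ≡ 3 + a′ + b′ × 2 + a + d ≡ 2 + a′ + d′) ⊎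
          (2 + a ≡ 3 + a′ + b′ × 3 + a + b + c ≡ 2 + a′ + d′ × 3 + a + b ≡ 2 + a′ × 2 + a + d ≡ 3 + a′ + b′ + c′) →
          (d , a , b , c , tt) ≡ (d′ , a′ , b′ , c′ , tt)
  equal (inj₁ (refl , p≡p′ , n≡n′ , q≡q′))
    with refl ← ℕ.+-cancelˡ-≡ (3 + a) b b′ n≡n′
    with refl ← ℕ.+-cancelˡ-≡ (3 + a + b) c c′ p≡p′
    with refl ← ℕ.+-cancelˡ-≡ (2 + a) d d′ q≡q′ = refl
  -- A crossed match would reverse the order of the star sizes.
  equal (inj₂ (m≡n′ , _ , n≡m′ , _)) = contradiction
    (ℕ.<-trans (ℕ.m≤m+n (3 + a) b) (subst₂ _<_ (sym n≡m′) (sym m≡n′) (ℕ.m≤m+n (3 + a′) b′)))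
    (ℕ.<-irrefl refl)

diagonal-injective : ∀ x y → diagonalTree x ≅ diagonalTree y → x ≡ y
diagonal-injective (a , b , c , _) (a′ , b′ , c′ , _) f =
  equal (merge-parameters (diagonal-parameters a b (b + c)) (diagonal-parameters a′ b′ (b′ + c′)) f)
  where
  equal : (3 + a ≡ 3 + a′ × 3 + a + b ≡ 3 + a′ + b′ × 3 + a ≡ 3 + a′ × 3 + a + (b + c) ≡ 3 + a′ + (b′ + c′)) ⊎
          (3 + a ≡ 3 + a′ × 3 + a + b ≡ 3 + a′ + (b′ + c′) × 3 + a ≡ 3 + a′ × 3 + a + (b + c) ≡ 3 + a′ + b′) →
          (a , b , c , tt) ≡ (a′ , b′ , c′ , tt)
  equal (inj₁ (refl , p≡p′ , _ , q≡q′))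
    with refl ← ℕ.+-cancelˡ-≡ (3 + a) b b′ p≡p′
    with refl ← ℕ.+-cancelˡ-≡ b c c′ (ℕ.+-cancelˡ-≡ (3 + a) (b + c) (b + c′) q≡q′) = refl
  -- A crossed match gives `b = b′ + c′` and `b + c = b′`, so `c` and `c′` are 0.
  equal (inj₂ (refl , p≡q′ , _ , q≡p′)) with refl ← ℕ.+-cancelˡ-≡ (3 + a) b (b′ + c′) p≡q′
    with c′+c≡0 ← ℕ.+-cancelˡ-≡ b′ (c′ + c) 0
           (trans (sym (ℕ.+-assoc b′ c′ c))
             (trans (ℕ.+-cancelˡ-≡ (3 + a) (b′ + c′ + c) b′ q≡p′) (sym (ℕ.+-identityʳ b′))))
    rewrite ℕ.m+n≡0⇒m≡0 c′ c′+c≡0 | ℕ.m+n≡0⇒n≡0 c′ c′+c≡0 | ℕ.+-identityʳ b′ = refl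

offDiagonal≇diagonal : ∀ x y → ¬ offDiagonalTree x ≅ diagonalTree y
offDiagonal≇diagonal (d , a , b , c , _) (a′ , b′ , c′ , _) f =
  ℕ.<⇒≢ (ℕ.<-≤-trans (ℕ.n<1+n (2 + a)) (ℕ.m≤m+n (3 + a) b))
    (equal (merge-parameters (offDiagonal-parameters d a b c) (diagonal-parameters a′ b′ (b′ + c′)) f))
  where
  equal : ∀ {m p n q k p′ q′ : ℕ} → (m ≡ k × p ≡ p′ × n ≡ k × q ≡ q′) ⊎ (m ≡ k × p ≡ q′ × n ≡ k × q ≡ p′) → m ≡ n
  equal (inj₁ (refl , _ , refl , _)) = refl
  equal (inj₂ (refl , _ , refl , _)) = refl

Represented : RootedTree → Set
Represented T = (∃ λ x → offDiagonalTree x ≅ T) ⊎ (∃ λ x → diagonalTree x ≅ T)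

represented-≅ : ∀ {T U} → T ≅ U → Represented T → Represented U
represented-≅ f (inj₁ (x , g)) = inj₁ (x , ≅-trans g f)
represented-≅ f (inj₂ (x , g)) = inj₂ (x , ≅-trans g f)

private
  represented-< : ∀ {m p n q} → m < n → NonUnimodalParameters m p n q → Represented (broom m p · broom n q)
  represented-< m<n (2≤m , _ , _ , n≤p , m≤q)
    with a , refl ← ℕ.m≤n⇒∃[o]m+o≡n 2≤m
    with b , refl ← ℕ.m≤n⇒∃[o]m+o≡n m<n
    with c , refl ← ℕ.m≤n⇒∃[o]m+o≡n n≤p
    with d , refl ← ℕ.m≤n⇒∃[o]m+o≡n m≤q
    = inj₁ ((d , a , b , c , tt) , ≅-refl)

  represented-≡ : ∀ {n p q} → p ≤ q → NonUnimodalParameters n p n q → Represented (broom n p · broom n q)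
  -- By `5 ≤ n + n` the common star size is at least 3, which is the offset in `diagonalTree`.
  represented-≡ {suc (suc zero)} p≤q (s≤s (s≤s _) , _ , s≤s (s≤s (s≤s (s≤s ()))) , _)
  represented-≡ {suc (suc (suc a))} p≤q (s≤s (s≤s _) , _ , _ , n≤p , _)
    with b , refl ← ℕ.m≤n⇒∃[o]m+o≡n n≤p
    with c , refl ← ℕ.m≤n⇒∃[o]m+o≡n p≤q
    = inj₂ ((a , b , c , tt) , subst
        (λ q → diagonalTree (a , b , c , tt) ≅ broom (3 + a) (3 + a + b) · broom (3 + a) q)
        (sym (ℕ.+-assoc (3 + a) b c)) ≅-refl)

  parameters-swap : ∀ {m p n q} → NonUnimodalParameters m p n q → NonUnimodalParameters n q m p
  parameters-swap {m} {n = n} (2≤m , 2≤n , 5≤m+n , n≤p , m≤q) =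
    2≤n , 2≤m , subst (5 ≤_) (ℕ.+-comm m n) 5≤m+n , m≤q , n≤p

represented : ∀ {m p n q} → NonUnimodalParameters m p n q → Represented (broom m p · broom n q)
represented {m} {p} {n} {q} bad with ℕ.<-cmp m n
... | tri< m<n _ _ = represented-< m<n bad
... | tri> _ _ n<m = represented-≅ (·-comm (broom n q) (broom m p)) (represented-< n<m (parameters-swap bad))
... | tri≈ _ refl _ with ℕ.≤-total p q
...   | inj₁ p≤q = represented-≡ p≤q bad
...   | inj₂ q≤p = represented-≅ (·-comm (broom n q) (broom m p)) (represented-≡ q≤p (parameters-swap bad))

-- Enumeration of the nonunimodal merges

-- The smallest merges have `m = 2`, `n = p = 3`, `q = 2` in the case `m < n`, and all parameters 3
-- in the case `m = n`. They have 11 and 13 vertices, whence the delays.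
count : ℕ → ℕ
count i = delay 11 parts₁₁₂₄ i + delay 13 parts₁₂₄ i

count-correct : ∀ i → HasCardinality (nonUnimodalBroomMerges i) (count i)
count-correct i = HasCardinality-+ (level (λ x → 11 + offDiagonalWeight x) i) (level (λ x → 13 + diagonalWeight x) i)
  (nonUnimodalBroomMerges i)
  offDiagonalMerge diagonalMerge
  (λ { {x , _} {.x , _} refl → ≅-refl }) (offDiagonal-injective _ _)
  (λ { {x , _} {.x , _} refl → ≅-refl }) (diagonal-injective _ _)
  (offDiagonal≇diagonal _ _)
  cover
  (delay-counts 11 offDiagonal-counts i) (delay-counts 13 diagonal-counts i)
  where
  Merge : Set
  Merge = Setoid.Carrier (nonUnimodalBroomMerges i)

  offDiagonalMerge : (∃ λ x → 11 + offDiagonalWeight x ≡ i) → Merge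
  offDiagonalMerge (x@(d , a , b , c , _) , e) =
    offDiagonalTree x , trans (offDiagonal-order x) e
    , (_ , _ , _ , _ , z<s , z<s , ≅-refl) , merge-not-rankUnimodal (offDiagonal-parameters d a b c)

  diagonalMerge : (∃ λ x → 13 + diagonalWeight x ≡ i) → Merge
  diagonalMerge (x@(a , b , c , _) , e) =
    diagonalTree x , trans (diagonal-order x) e
    , (_ , _ , _ , _ , z<s , z<s , ≅-refl) , merge-not-rankUnimodal (diagonal-parameters a b (b + c))

  parameters : ∀ {m p n q} {T : RootedTree} → 0 < m → 0 < n → T ≅ broom m p · broom n q → ¬ RankUnimodal T →
    NonUnimodalParameters m p n q
  parameters {m} {p} {n} {q} 0<m 0<n f not-unimodal with nonUnimodalParameters? m p n q
  ... | yes bad   = bad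
  ... | no  unbad = contradiction (≅-rankUnimodal f (merge-rankUnimodal 0<m 0<n unbad)) not-unimodal

  cover : ((T , z) : Merge) →
    (∃ λ x → proj₁ (offDiagonalMerge x) ≅ T) ⊎ (∃ λ x → proj₁ (diagonalMerge x) ≅ T)
  cover (T , order≡ , (m , p , n , q , 0<m , 0<n , f) , not-unimodal)
    with represented-≅ (≅-sym f) (represented (parameters 0<m 0<n f not-unimodal))
  ... | inj₁ (x , g) = inj₁ ((x , trans (sym (offDiagonal-order x)) (trans (↔⇒≡ (_≅_.bijection g)) order≡)) , g)
  ... | inj₂ (x , g) = inj₂ ((x , trans (sym (diagonal-order x)) (trans (↔⇒≡ (_≅_.bijection g)) order≡)) , g)

-- Closed formulas

-- The coefficients `parts₁₂₄` and the summands `term` both reduce to this sequence, whose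
-- recurrence `quarterSquare-+2` is the same for both parities.
quarterSquare : ℕ → ℕ
quarterSquare k = k ^ 2 / 4

[m+n*4]/4 : ∀ m n → (m + n * 4) / 4 ≡ m / 4 + n
[m+n*4]/4 m n = trans (+-distrib-/-∣ʳ m (n∣m*n n)) (cong (_+_ (m / 4)) (m*n/n≡m n 4))

quarterSquare-+2 : ∀ k → quarterSquare (2 + k) ≡ quarterSquare k + (k + 1)
quarterSquare-+2 k = trans (cong (_/ 4) (lemma k)) ([m+n*4]/4 (k ^ 2) (k + 1))
  where
  lemma : ∀ k → (2 + k) * ((2 + k) * 1) ≡ k * (k * 1) + (k + 1) * 4
  lemma = ℕ.solve-∀

term : ℕ → ℕ
term i = i * (i + 4) / 4

-- Completing the square: `i (i + 4) + 4 = (i + 2)^2`, and the 4 becomes 1 after division.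
term-quarterSquare : ∀ i → term i + 1 ≡ quarterSquare (2 + i)
term-quarterSquare i = trans (sym ([m+n*4]/4 (i * (i + 4)) 1)) (cong (_/ 4) (lemma i))
  where
  lemma : ∀ i → i * (i + 4) + 1 * 4 ≡ (2 + i) * ((2 + i) * 1)
  lemma = ℕ.solve-∀

-- Both sides equal `quarterSquare k + quarterSquare (1 + k) + (k + 1)`. This turns the growth of
-- the counts into the next summand of the closed formula.
term-suc : ∀ k → term (suc k) + quarterSquare k ≡ quarterSquare (2 + k) + quarterSquare (1 + k)
term-suc k = ℕ.+-cancelʳ-≡ 1 _ _ (trans (lemma (term (suc k)) (quarterSquare k)) (trans
  (cong (λ t → t + quarterSquare k) (trans (term-quarterSquare (suc k)) (quarterSquare-+2 (suc k))))
  (trans (lemma′ (quarterSquare (suc k)) k (quarterSquare k))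
    (cong (λ t → t + quarterSquare (suc k) + 1) (sym (quarterSquare-+2 k))))))
  where
  lemma : ∀ t e → t + e + 1 ≡ t + 1 + e
  lemma = ℕ.solve-∀
  lemma′ : ∀ e₁ k e → e₁ + (1 + k + 1) + e ≡ e + (k + 1) + e₁ + 1
  lemma′ = ℕ.solve-∀

sumTo-suc : ∀ k f → sumTo (suc k) f ≡ sumTo k f + f (suc k)
sumTo-suc k f = begin
  sum (List.map f (List.upTo (2 + k)))                        ≡⟨ cong (sum ∘ List.map f) (upTo-∷ʳ (suc k)) ⟨
  sum (List.map f (List.upTo (suc k) List.∷ʳ suc k))     ≡⟨ cong sum (map-++ f (List.upTo (suc k)) List.[ suc k ]) ⟩
  sum (List.map f (List.upTo (suc k)) List.++ List.[ f (suc k) ]) ≡⟨ sum-++ (List.map f (List.upTo (suc k))) List.[ f (suc k) ] ⟩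
  sumTo k f + (f (suc k) + 0)                       ≡⟨ cong (_+_ (sumTo k f)) (ℕ.+-identityʳ _) ⟩
  sumTo k f + f (suc k)                             ∎
  where open ≡-Reasoning

parts₁₂-even : ∀ k → parts₁₂ (2 * k) ≡ k + 1
parts₁₂-even zero    = refl
parts₁₂-even (suc k) = trans (cong parts₁₂ (ℕ.*-suc 2 k)) (cong suc (parts₁₂-even k))

parts₁₂-odd : ∀ k → parts₁₂ (1 + 2 * k) ≡ k + 1
parts₁₂-odd zero    = refl
parts₁₂-odd (suc k) = trans (cong (parts₁₂ ∘ suc) (ℕ.*-suc 2 k)) (cong suc (parts₁₂-odd k))

private
  2*[2+k] : ∀ k → 2 * (2 + k) ≡ 4 + 2 * k
  2*[2+k] k = trans (ℕ.*-suc 2 (suc k)) (cong (_+_ 2) (ℕ.*-suc 2 k))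

  -- Serves `i = 2 * k` and `i = 1 + 2 * k` alike: the recurrence adds `k + 3`, as does passing from
  -- `2 + k` to `4 + k` in `quarterSquare`.
  parts₁₂₄-step : ∀ k i → parts₁₂ i ≡ k + 1 → parts₁₂₄ i ≡ quarterSquare (2 + k) →
    parts₁₂₄ (4 + i) ≡ quarterSquare (4 + k)
  parts₁₂₄-step k i e₁ e₂ = begin
    2 + parts₁₂ i + parts₁₂₄ i             ≡⟨ cong₂ (λ a b → 2 + a + b) e₁ e₂ ⟩
    2 + (k + 1) + quarterSquare (2 + k)    ≡⟨ ℕ.+-comm (2 + (k + 1)) _ ⟩
    quarterSquare (2 + k) + (2 + k + 1)    ≡⟨ quarterSquare-+2 (2 + k) ⟨
    quarterSquare (4 + k)                  ∎
    where open ≡-Reasoning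

parts₁₂₄-even : ∀ k → parts₁₂₄ (2 * k) ≡ quarterSquare (2 + k)
parts₁₂₄-even 0 = refl
parts₁₂₄-even 1 = refl
parts₁₂₄-even (suc (suc k)) = trans (cong parts₁₂₄ (2*[2+k] k))
  (parts₁₂₄-step k (2 * k) (parts₁₂-even k) (parts₁₂₄-even k))

parts₁₂₄-odd : ∀ k → parts₁₂₄ (1 + 2 * k) ≡ quarterSquare (2 + k)
parts₁₂₄-odd 0 = refl
parts₁₂₄-odd 1 = refl
parts₁₂₄-odd (suc (suc k)) = trans (cong (parts₁₂₄ ∘ suc) (2*[2+k] k))
  (parts₁₂₄-step k (1 + 2 * k) (parts₁₂-odd k) (parts₁₂₄-odd k))

private
  S : ℕ → ℕ
  S k = sumTo k term

  -- `X k` counts the nonunimodal merges with `m < n` on `10 + 2 * k` vertices.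
  E X : ℕ → ℕ
  E = quarterSquare
  X k = delay 11 parts₁₁₂₄ (10 + 2 * k)

  X-suc : ∀ k → X (suc k) ≡ parts₁₁₂₄ (1 + 2 * k)
  X-suc k = cong (λ t → delay 11 parts₁₁₂₄ (10 + t)) (ℕ.*-suc 2 k)

  offDiagonal-odd : ∀ k → parts₁₁₂₄ (2 * k) ≡ X k + E (2 + k)
  offDiagonal-odd zero    = refl
  offDiagonal-odd (suc k) = begin
    parts₁₁₂₄ (2 * suc k)                            ≡⟨ cong parts₁₁₂₄ (ℕ.*-suc 2 k) ⟩
    parts₁₂₄ (2 + 2 * k) + parts₁₁₂₄ (1 + 2 * k)     ≡⟨ cong₂ _+_ (trans (cong parts₁₂₄ (sym (ℕ.*-suc 2 k))) (parts₁₂₄-even (suc k))) (sym (X-suc k)) ⟩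
    E (3 + k) + X (suc k)                            ≡⟨ ℕ.+-comm (E (3 + k)) (X (suc k)) ⟩
    X (suc k) + E (3 + k)                            ∎
    where open ≡-Reasoning

  -- Two more vertices add `E (2 + k)` twice, which `term-suc` converts into the next summand. One
  -- `E k` will stand for the merges with `m = n`, the other for the square subtracted in the
  -- theorem.
  offDiagonal-even : ∀ k → X k + 2 * E k ≡ 2 * S k
  offDiagonal-even zero    = refl
  offDiagonal-even (suc k) = begin
    X (suc k) + 2 * E (suc k)                                   ≡⟨ cong (λ t → t + 2 * E (suc k)) (X-suc k) ⟩
    parts₁₂₄ (1 + 2 * k) + parts₁₁₂₄ (2 * k) + 2 * E (suc k)    ≡⟨ cong₂ (λ a b → a + b + 2 * E (suc k)) (parts₁₂₄-odd k) (offDiagonal-odd k) ⟩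
    E (2 + k) + (X k + E (2 + k)) + 2 * E (suc k)               ≡⟨ lemma (E (2 + k)) (X k) (E (suc k)) ⟩
    X k + 2 * (E (2 + k) + E (suc k))                           ≡⟨ cong (λ t → X k + 2 * t) (term-suc k) ⟨
    X k + 2 * (term (suc k) + E k)                              ≡⟨ lemma′ (X k) (term (suc k)) (E k) ⟩
    X k + 2 * E k + 2 * term (suc k)                            ≡⟨ cong (λ t → t + 2 * term (suc k)) (offDiagonal-even k) ⟩
    2 * S k + 2 * term (suc k)                                  ≡⟨ ℕ.*-distribˡ-+ 2 (S k) (term (suc k)) ⟨
    2 * (S k + term (suc k))                                    ≡⟨ cong (_*_ 2) (sumTo-suc k term) ⟨
    2 * S (suc k)                                               ∎
    where
    open ≡-Reasoning
    lemma : ∀ a x b → a + (x + a) + 2 * b ≡ x + 2 * (a + b)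
    lemma = ℕ.solve-∀
    lemma′ : ∀ x t e → x + 2 * (t + e) ≡ x + 2 * e + 2 * t
    lemma′ = ℕ.solve-∀

  diagonal-even : ∀ k → delay 13 parts₁₂₄ (10 + 2 * k) ≡ E k
  -- Orders 10 and 12 lie below the delay 13, in accordance with `E 0 = E 1 = 0`.
  diagonal-even 0 = refl
  diagonal-even 1 = refl
  diagonal-even (suc (suc k)) =
    trans (cong (λ t → delay 13 parts₁₂₄ (10 + t)) (2*[2+k] k)) (parts₁₂₄-odd k)

  diagonal-odd : ∀ k → delay 13 parts₁₂₄ (11 + 2 * k) ≡ E (1 + k)
  diagonal-odd 0 = refl
  diagonal-odd (suc k) = trans (cong (λ t → delay 13 parts₁₂₄ (11 + t)) (ℕ.*-suc 2 k)) (parts₁₂₄-even k)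

count-even : ∀ k → count (10 + 2 * k) + quarterSquare k ≡ 2 * sumTo k term
count-even k = begin
  X k + delay 13 parts₁₂₄ (10 + 2 * k) + E k    ≡⟨ cong (λ t → X k + t + E k) (diagonal-even k) ⟩
  X k + E k + E k                               ≡⟨ lemma (X k) (E k) ⟩
  X k + 2 * E k                                 ≡⟨ offDiagonal-even k ⟩
  2 * S k                                       ∎
  where
  open ≡-Reasoning
  lemma : ∀ x e → x + e + e ≡ x + 2 * e
  lemma = ℕ.solve-∀

count-odd : ∀ k → count (11 + 2 * k) + quarterSquare k ≡ 2 * sumTo k term + term (suc k)
count-odd k = begin
  parts₁₁₂₄ (2 * k) + delay 13 parts₁₂₄ (11 + 2 * k) + E k  ≡⟨ cong₂ (λ a b → a + b + E k) (offDiagonal-odd k) (diagonal-odd k) ⟩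
  X k + E (2 + k) + E (1 + k) + E k                         ≡⟨ cong (λ t → t + E k) (ℕ.+-assoc (X k) _ _) ⟩
  X k + (E (2 + k) + E (1 + k)) + E k                       ≡⟨ cong (λ t → X k + t + E k) (term-suc k) ⟨
  X k + (term (suc k) + E k) + E k                          ≡⟨ lemma (X k) (term (suc k)) (E k) ⟩
  X k + 2 * E k + term (suc k)                              ≡⟨ cong (λ t → t + term (suc k)) (offDiagonal-even k) ⟩
  2 * S k + term (suc k)                                    ∎
  where
  open ≡-Reasoning
  lemma : ∀ x t e → x + (t + e) + e ≡ x + 2 * e + t
  lemma = ℕ.solve-∀

+≡⇒≡- : ∀ {a b c} → a + b ≡ c → + a ≡ + c ℤ.- + b
+≡⇒≡- {a} {b} refl = lemma (+ a) (+ b)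
  where
  lemma : ∀ a b → a ≡ a ℤ.+ b ℤ.- b
  lemma = solve-∀

theorem5p2 : ∃ λ (b : ℕ → ℕ) →
    (∀ i → 1 ≤ i → HasCardinality (nonUnimodalBroomMerges i) (b i))
    × (∀ i → 1 ≤ i → i ≤ 9 → b i ≡ 0)
    × (∀ (k : ℕ) → + b (2 * k + 10)
    ≡ + (2 * sumTo k (λ i → i * (i + 4) / 4)) ℤ.- + (k ^ 2 / 4))
    × (∀ (k : ℕ) → + b (2 * k + 11)
    ≡ + (2 * sumTo k (λ i → i * (i + 4) / 4)) ℤ.+ + ((k + 1) * (k + 5) / 4) ℤ.- + (k ^ 2 / 4))
theorem5p2 =
  count
  , (λ i _ → count-correct i)
  , (λ i _ i≤9 → small i≤9)
  , (λ k → +≡⇒≡- (trans (cong (λ t → count t + quarterSquare k) (ℕ.+-comm (2 * k) 10)) (count-even k)))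
  , (λ k → +≡⇒≡- (trans (cong (λ t → count t + quarterSquare k) (ℕ.+-comm (2 * k) 11))
      (trans (count-odd k) (cong (λ t → 2 * sumTo k term + t / 4) (lemma k)))))
  where
  lemma : ∀ k → suc k * (suc k + 4) ≡ (k + 1) * (k + 5)
  lemma = ℕ.solve-∀
  delay-small : ∀ {f i k} → i < k → delay k f i ≡ 0
  delay-small {i = zero}  {suc k} _         = refl
  delay-small {i = suc i} {suc k} (s≤s i<k) = delay-small i<k
  small : ∀ {i} → i ≤ 9 → count i ≡ 0
  small i≤9 = cong₂ _+_ (delay-small (ℕ.≤-trans (s≤s i≤9) (ℕ.m≤m+n 10 1))) (delay-small (ℕ.≤-trans (s≤s i≤9) (ℕ.m≤m+n 10 3)))
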